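{- Let $P$ be a non-exceptional isonemal periodic prefabric that has quarter-turn symmetry and that falls apart. Then there exist a fabric $F$ and a thick striping of the strands of $F$ such that the resulting pattern is the design of $P$, and such that $F$ is of species $33_4$ or the symmetry group of $F$ has a subgroup of Roth type $33_4$.
   Context: **Prefabrics.** The plane is divided into unit square cells $[i,i+1]\times[j,j+1]$, $i,j\in\mathbb{Z}$. Each column of cells is a vertical strand (a warp) and each row a horizontal strand (a weft). A prefabric specifies, for each cell, which of the two strands crossing there is on top (seen from the obverse side). Its design is the colouring of the cells in which a cell is dark if the warp is on top and pale if the weft is on top (normal colouring: dark warps, pale wefts). All prefabrics are periodic: the designs are invariant under two linearly independent translations. A prefabric falls apart if the set of strands can be partitioned into two nonempty sets $A,B$ such that wherever a strand of $A$ crosses a strand of $B$ the strand of $A$ is on top. A fabric is a prefabric that does not fall apart. **Symmetries.** A symmetry of a prefabric is a pair $(g,\varepsilon)$ where $g$ is an isometry of the plane mapping cells to cells and $\varepsilon\in\{e,\tau\}$ ($e$ = without reversal of sides, $\tau$ = reflection in the plane of the fabric, exchanging over and under), such that for every cell $c$ the strand on top at $c$ is carried by $g$ to the strand on top at $g(c)$ if $\varepsilon=e$, and to the strand underneath at $g(c)$ if $\varepsilon=\tau$. The symmetries form a group, the symmetry group. The prefabric has quarter-turn symmetry if this group contains some $(g,\varepsilon)$ with $g$ a rotation by $90^\circ$. The prefabric is isonemal if its symmetry group is transitive on the set of all strands (warps and wefts together). The order of an isonemal prefabric is the least positive integer $p$ such that the translation by $(p,0)$, without $\tau$, is a symmetry.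 **Exceptional prefabrics.** Roth's classification places isonemal periodic prefabrics in 39 species, apart from a finite list of exceptional ones (all of order at most $4$); non-exceptional means belonging to one of the 39 species. Species with quarter-turn symmetry (33–39) have no reflection or glide-reflection symmetries, so for a prefabric with quarter-turn symmetry, non-exceptional means that no symmetry $(g,\varepsilon)$ has $g$ a reflection or glide-reflection. **Species $33_4$.** A group is of (Roth) type $33_4$ if it is generated by the quarter-turns without $\tau$ about two points $c$ and $d$, where $c$ and $d$ are corners of cells and $d-c=(2a,2b)$ with $a,b$ coprime integers of opposite parity. A prefabric is of species $33_4$ if its (full) symmetry group is of type $33_4$. **Thick striping.** A thick striping colours the warps dark and pale alternately in adjacent pairs (dark, dark, pale, pale, dark, dark, ...), and likewise the wefts; the positions of the pairs among the warps and among the wefts are arbitrary. The pattern of a fabric with coloured strands is the colouring of the cells in which each cell has the colour of the strand on top there. -}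

module Defs where

open import Data.Bool.Base using (Bool; true; false; if_then_else_)
open import Data.Integer.Base
  using (ℤ; +_; _+_; _-_; -_; _*_; 0ℤ; 1ℤ; _%ℕ_)
open import Data.Integer.Coprimality using (Coprime)
open import Data.Integer.Divisibility using (_∣_)
open import Data.Nat.Base using (_<ᵇ_)
open import Data.Product.Base using (Σ-syntax; ∃; ∃-syntax; ∃₂; _×_; _,_; proj₁)
open import Data.Sign.Base as Sign using (Sign)
open import Data.Sum.Base using (_⊎_)
open import Level using (0ℓ)
open import Relation.Binary.PropositionalEquality.Core using (_≡_; _≢_)
open import Relation.Nullary.Negation.Core using (¬_)
open import Relation.Unary using (Pred; ｛_｝; _∪_; _⊆_; _≐_)

data Colour : Set where
  dark pale : Colour

-- (i , j) is the cell [i,i+1] × [j,j+1].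
Cell : Set
Cell = ℤ × ℤ

Corner : Set
Corner = ℤ × ℤ

-- warp i is the column [i,i+1] × ℝ, weft j is the row ℝ × [j,j+1].
data Strand : Set where
  warp weft : ℤ → Strand

Design : Set
Design = Cell → Colour

-- Non-vanishing of the determinant is linear independence of the two
-- translations.
Periodic : Design → Set
Periodic δ =
  ∃₂ λ ((u₁ , u₂) (v₁ , v₂) : ℤ × ℤ) →
    u₁ * v₂ - u₂ * v₁ ≢ 0ℤ ×
    (∀ i j → δ (i + u₁ , j + u₂) ≡ δ (i , j)) ×
    (∀ i j → δ (i + v₁ , j + v₂) ≡ δ (i , j))

-- A cell is dark when the warp is on top there, pale when the weft is.
record Prefabric : Set where
  field
    design   : Design
    periodic : Periodic design

open Prefabric public

top : Prefabric → Cell → Strand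
top P c@(i , j) with design P c
... | dark = warp i
... | pale = weft j

under : Prefabric → Cell → Strand
under P c@(i , j) with design P c
... | dark = weft j
... | pale = warp i

-- The Boolean function A is the partition of the strands into A (true) and
-- B (false).
FallsApart : Prefabric → Set
FallsApart P =
  Σ[ A ∈ (Strand → Bool) ]
    (∃[ s ] A s ≡ true) ×
    (∃[ s ] A s ≡ false) ×
    (∀ c → A (top P c) ≢ A (under P c) → A (top P c) ≡ true)

IsFabric : Prefabric → Set
IsFabric P = ¬ FallsApart P

-- The isometries of the real line that preserve ℤ:
-- shift t is x ↦ x + t and flip t is x ↦ t - x.
data LineIsometry : Set where
  shift flip : ℤ → LineIsometry

-- The image of the interval [i,i+1], named by its left endpoint.
onInterval : LineIsometry → ℤ → ℤ
onInterval (shift t) i = i + t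
onInterval (flip  t) i = t - (i + 1ℤ)

_∘ˡ_ : LineIsometry → LineIsometry → LineIsometry
shift t ∘ˡ shift u = shift (u + t)
shift t ∘ˡ flip  u = flip (u + t)
flip  t ∘ˡ shift u = flip (t - u)
flip  t ∘ˡ flip  u = shift (t - u)

invˡ : LineIsometry → LineIsometry
invˡ (shift t) = shift (- t)
invˡ (flip  t) = flip t

-- The isometries of the plane that map cells to cells: the linear part
-- permutes the coordinate axes up to sign, and corners go to corners.
-- straight X Y is (x , y) ↦ (X x , Y y); crossed X Y is (x , y) ↦ (X y , Y x).
data Isometry : Set where
  straight crossed : (X Y : LineIsometry) → Isometry

onCell : Isometry → Cell → Cell
onCell (straight X Y) (i , j) = onInterval X i , onInterval Y j
onCell (crossed  X Y) (i , j) = onInterval X j , onInterval Y i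

onStrand : Isometry → Strand → Strand
onStrand (straight X Y) (warp i) = warp (onInterval X i)
onStrand (straight X Y) (weft j) = weft (onInterval Y j)
onStrand (crossed  X Y) (warp i) = weft (onInterval Y i)
onStrand (crossed  X Y) (weft j) = warp (onInterval X j)

identity : Isometry
identity = straight (shift 0ℤ) (shift 0ℤ)

_∘ⁱ_ : Isometry → Isometry → Isometry
straight X Y ∘ⁱ straight X′ Y′ = straight (X ∘ˡ X′) (Y ∘ˡ Y′)
straight X Y ∘ⁱ crossed  X′ Y′ = crossed  (X ∘ˡ X′) (Y ∘ˡ Y′)
crossed  X Y ∘ⁱ straight X′ Y′ = crossed  (X ∘ˡ Y′) (Y ∘ˡ X′)
crossed  X Y ∘ⁱ crossed  X′ Y′ = straight (X ∘ˡ Y′) (Y ∘ˡ X′)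

invⁱ : Isometry → Isometry
invⁱ (straight X Y) = straight (invˡ X) (invˡ Y)
invⁱ (crossed  X Y) = crossed  (invˡ Y) (invˡ X)

-- Rotations by 90°, anticlockwise and clockwise respectively.
data QuarterTurn : Pred Isometry 0ℓ where
  anticlockwise : ∀ t u → QuarterTurn (crossed (flip t) (shift u))
  clockwise     : ∀ t u → QuarterTurn (crossed (shift t) (flip u))

-- The reflections and glide-reflections are the isometries whose linear part
-- has determinant -1.
data ReflectionOrGlide : Pred Isometry 0ℓ where
  vertical     : ∀ t u → ReflectionOrGlide (straight (flip t) (shift u))
  horizontal   : ∀ t u → ReflectionOrGlide (straight (shift t) (flip u))
  diagonal     : ∀ t u → ReflectionOrGlide (crossed (shift t) (shift u))
  antidiagonal : ∀ t u → ReflectionOrGlide (crossed (flip t) (flip u))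

-- The anticlockwise quarter-turn (x , y) ↦ (p - (y - q) , q + (x - p)).
quarterTurnAbout : Corner → Isometry
quarterTurnAbout (p , q) = crossed (flip (p + q)) (shift (q - p))

-- The second component of a motion records reversal of sides: e without,
-- τ with.
pattern e = Sign.+
pattern τ = Sign.-

Motion : Set
Motion = Isometry × Sign

_∙_ : Motion → Motion → Motion
(g , s) ∙ (h , t) = g ∘ⁱ h , s Sign.* t

unit : Motion
unit = identity , e

_⁻¹ : Motion → Motion
(g , s) ⁻¹ = invⁱ g , s

Symmetry : Prefabric → Pred Motion 0ℓ
Symmetry P (g , e) = ∀ c → onStrand g (top P c) ≡ top P (onCell g c)
Symmetry P (g , τ) = ∀ c → onStrand g (top P c) ≡ under P (onCell g c)

HasQuarterTurnSymmetry : Prefabric → Set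
HasQuarterTurnSymmetry P = ∃[ m ] Symmetry P m × QuarterTurn (proj₁ m)

Isonemal : Prefabric → Set
Isonemal P = ∀ s t → ∃[ m ] Symmetry P m × onStrand (proj₁ m) s ≡ t

-- This expresses non-exceptionality only for prefabrics with quarter-turn
-- symmetry: the species having such symmetry have no (glide-)reflections.
NonExceptional : Prefabric → Set
NonExceptional P = ∀ m → Symmetry P m → ¬ ReflectionOrGlide (proj₁ m)

data ⟨_⟩ (S : Pred Motion 0ℓ) : Pred Motion 0ℓ where
  generator : ∀ {m} → S m → ⟨ S ⟩ m
  neutral   : ⟨ S ⟩ unit
  product   : ∀ {m n} → ⟨ S ⟩ m → ⟨ S ⟩ n → ⟨ S ⟩ (m ∙ n)
  inverse   : ∀ {m} → ⟨ S ⟩ m → ⟨ S ⟩ (m ⁻¹)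

OppositeParity : ℤ → ℤ → Set
OppositeParity a b =
  (+ 2 ∣ a × ¬ (+ 2 ∣ b)) ⊎ (¬ (+ 2 ∣ a) × + 2 ∣ b)

-- Any such H is automatically a subgroup of the group of motions.
Type33₄ : Pred Motion 0ℓ → Set
Type33₄ H =
  ∃₂ λ ((p , q) : Corner) ((a , b) : ℤ × ℤ) →
    Coprime a b × OppositeParity a b ×
    H ≐ ⟨ ｛ quarterTurnAbout (p , q) , e ｝
        ∪ ｛ quarterTurnAbout (p + + 2 * a , q + + 2 * b) , e ｝ ⟩

Species33₄ : Prefabric → Set
Species33₄ P = Type33₄ (Symmetry P)

HasSubgroup33₄ : Prefabric → Set₁
HasSubgroup33₄ P = Σ[ H ∈ Pred Motion 0ℓ ] Type33₄ H × H ⊆ Symmetry P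

Striping : Set
Striping = Strand → Colour

-- Dark, dark, pale, pale, repeated, with a dark pair at p, p + 1.
pairs : ℤ → ℤ → Colour
pairs p i = if (i - p) %ℕ 4 <ᵇ 2 then dark else pale

thickStriping : (p q : ℤ) → Striping
thickStriping p q (warp i) = pairs p i
thickStriping p q (weft j) = pairs q j

patternOf : Prefabric → Striping → Design
patternOf F κ c = κ (top F c)

{-# OPTIONS --safe #-}
module Submission where

-- The score of a strand is the number of its crossings in a period at which it
-- is on top.  As P is isonemal and falls apart, scores take two distinct values,
-- and strands of the higher score (level dark) lie over those of the lower
-- (level pale); symmetries without τ preserve levels, those with τ exchange
-- them.  Without reflections the motions are rotations and translations, and
-- transitivity forces a quarter-turn Q about a corner of cells, together with a
-- τ-translation T by (2 , 4k+2); along the warps and along the wefts, the levels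
-- then read dark, dark, pale, pale, ....  F agrees with P where two dark strands
-- cross, reverses P where two pale strands cross, and is a plain weave
-- elsewhere.  This makes the quarter-turns Q and TQ symmetries of F without τ,
-- whatever their signs in P; their centres differ by 2(-k , k+1).  They are
-- transitive on strands, so all scores in F are equal and F is a fabric.

open import Defs
open import Data.Product.Base using (Σ-syntax; ∃₂; _×_)
open import Data.Sum.Base using (_⊎_)
open import Relation.Binary.PropositionalEquality.Core using (_≡_)

open import Algebra.Properties.CommutativeSemigroup using (interchange)
open import Data.Bool.Base using (Bool; true; false; not; if_then_else_)
open import Data.Bool.Properties using (not-injective)
open import Data.Empty using (⊥)
open import Data.Integer.Base
  using (ℤ; +_; -[1+_]; _+_; _-_; -_; _*_; 0ℤ; 1ℤ; ∣_∣; _%ℕ_)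
open import Data.Integer.Coprimality using (Coprime)
open import Data.Integer.Divisibility using (_∣_)
import Data.Integer.Divisibility.Signed as Signed
import Data.Integer.Properties as ℤ
open import Data.Integer.Tactic.RingSolver using (solve-∀)
open import Data.Nat.Base as ℕ using (ℕ; zero; suc)
import Data.Nat.Divisibility as ℕ
import Data.Nat.Properties as ℕ
open import Data.Product.Base using (∃-syntax; _,_; proj₁; proj₂)
open import Data.Sign.Base as Sign using (Sign)
import Data.Sign.Properties as Sign
open import Data.Sum.Base using (inj₁; inj₂)
open import Function.Base using (_∘_; id)
open import Relation.Binary.Definitions using (tri<; tri≈; tri>)
open import Relation.Binary.PropositionalEquality
  using (_≢_; refl; sym; trans; cong; cong₂; subst; module ≡-Reasoning)
open import Relation.Nullary.Negation.Core using (¬_; contradiction)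
open import Relation.Unary using (_⊆_)

-- Colours and signs

opp : Colour → Colour
opp dark = pale
opp pale = dark

opp-involutive : ∀ x → opp (opp x) ≡ x
opp-involutive dark = refl
opp-involutive pale = refl

opp≢ : ∀ {x} → opp x ≢ x
opp≢ {dark} ()
opp≢ {pale} ()

act : Sign → Colour → Colour
act e = id
act τ = opp

act-* : ∀ s t x → act (s Sign.* t) x ≡ act s (act t x)
act-* e _ _ = refl
act-* τ e _ = refl
act-* τ τ x = sym (opp-involutive x)

act-involutive : ∀ s x → act s (act s x) ≡ x
act-involutive e _ = refl
act-involutive τ = opp-involutive

-- Symmetries in terms of designs

-- Here `τ` marks the isometries that exchange warps and wefts, not those that reverse orientation.
handed : Isometry → Sign
handed (straight _ _) = e
handed (crossed  _ _) = τ

-- Exchanging warps with wefts and reversing the sides each swap the meanings of dark and pale, so a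
-- cell changes colour exactly when one of the two happens without the other.
Invariant : Design → Motion → Set
Invariant δ (g , s) = ∀ c → δ (onCell g c) ≡ act (handed g Sign.* s) (δ c)

symmetry⇒invariant : ∀ P m → Symmetry P m → Invariant (design P) m
symmetry⇒invariant P (straight X Y , e) S c
  with design P c | design P (onCell (straight X Y) c) | S c
... | dark | dark | _  = refl
... | dark | pale | ()
... | pale | dark | ()
... | pale | pale | _  = refl
symmetry⇒invariant P (straight X Y , τ) S c
  with design P c | design P (onCell (straight X Y) c) | S c
... | dark | dark | ()
... | dark | pale | _  = refl
... | pale | dark | _  = refl
... | pale | pale | ()
symmetry⇒invariant P (crossed X Y , e) S c
  with design P c | design P (onCell (crossed X Y) c) | S c
... | dark | dark | ()
... | dark | pale | _  = refl
... | pale | dark | _  = refl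
... | pale | pale | ()
symmetry⇒invariant P (crossed X Y , τ) S c
  with design P c | design P (onCell (crossed X Y) c) | S c
... | dark | dark | _  = refl
... | dark | pale | ()
... | pale | dark | ()
... | pale | pale | _  = refl

invariant⇒symmetry : ∀ P m → Invariant (design P) m → Symmetry P m
invariant⇒symmetry P (straight X Y , e) I c
  with design P c | design P (onCell (straight X Y) c) | I c
... | dark | .dark | refl = refl
... | pale | .pale | refl = refl
invariant⇒symmetry P (straight X Y , τ) I c
  with design P c | design P (onCell (straight X Y) c) | I c
... | dark | .pale | refl = refl
... | pale | .dark | refl = refl
invariant⇒symmetry P (crossed X Y , e) I c
  with design P c | design P (onCell (crossed X Y) c) | I c
... | dark | .pale | refl = refl
... | pale | .dark | refl = refl
invariant⇒symmetry P (crossed X Y , τ) I c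
  with design P c | design P (onCell (crossed X Y) c) | I c
... | dark | .dark | refl = refl
... | pale | .pale | refl = refl

-- Composition and inversion of motions

shift-shift : ∀ t u i → i + (u + t) ≡ i + u + t
shift-shift = solve-∀

shift-flip : ∀ t u i → (u + t) - (i + 1ℤ) ≡ u - (i + 1ℤ) + t
shift-flip = solve-∀

flip-shift : ∀ t u i → (t - u) - (i + 1ℤ) ≡ t - (i + u + 1ℤ)
flip-shift = solve-∀

flip-flip : ∀ t u i → i + (t - u) ≡ t - (u - (i + 1ℤ) + 1ℤ)
flip-flip = solve-∀

shift-inverse : ∀ t i → i + - t + t ≡ i
shift-inverse = solve-∀

flip-inverse : ∀ t i → t - (t - (i + 1ℤ) + 1ℤ) ≡ i
flip-inverse = solve-∀

onInterval-∘ : ∀ X Y i → onInterval (X ∘ˡ Y) i ≡ onInterval X (onInterval Y i)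
onInterval-∘ (shift t) (shift u) = shift-shift t u
onInterval-∘ (shift t) (flip u)  = shift-flip t u
onInterval-∘ (flip t)  (shift u) = flip-shift t u
onInterval-∘ (flip t)  (flip u)  = flip-flip t u

onInterval-inv : ∀ X i → onInterval X (onInterval (invˡ X) i) ≡ i
onInterval-inv (shift t) = shift-inverse t
onInterval-inv (flip t)  = flip-inverse t

onCell-∘ : ∀ g h c → onCell (g ∘ⁱ h) c ≡ onCell g (onCell h c)
onCell-∘ (straight X Y) (straight X′ Y′) (i , j) =
  cong₂ _,_ (onInterval-∘ X X′ i) (onInterval-∘ Y Y′ j)
onCell-∘ (straight X Y) (crossed X′ Y′) (i , j) =
  cong₂ _,_ (onInterval-∘ X X′ j) (onInterval-∘ Y Y′ i)
onCell-∘ (crossed X Y) (straight X′ Y′) (i , j) =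
  cong₂ _,_ (onInterval-∘ X Y′ j) (onInterval-∘ Y X′ i)
onCell-∘ (crossed X Y) (crossed X′ Y′) (i , j) =
  cong₂ _,_ (onInterval-∘ X Y′ i) (onInterval-∘ Y X′ j)

onCell-inv : ∀ g c → onCell g (onCell (invⁱ g) c) ≡ c
onCell-inv (straight X Y) (i , j) = cong₂ _,_ (onInterval-inv X i) (onInterval-inv Y j)
onCell-inv (crossed X Y)  (i , j) = cong₂ _,_ (onInterval-inv X i) (onInterval-inv Y j)

handed-∘ : ∀ g h → handed (g ∘ⁱ h) ≡ handed g Sign.* handed h
handed-∘ (straight _ _) (straight _ _) = refl
handed-∘ (straight _ _) (crossed _ _)  = refl
handed-∘ (crossed _ _)  (straight _ _) = refl
handed-∘ (crossed _ _)  (crossed _ _)  = refl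

handed-inv : ∀ g → handed (invⁱ g) ≡ handed g
handed-inv (straight _ _) = refl
handed-inv (crossed _ _)  = refl

invariant-∙ : ∀ δ m n → Invariant δ m → Invariant δ n → Invariant δ (m ∙ n)
invariant-∙ δ (g , s) (h , t) I J c = begin
  δ (onCell (g ∘ⁱ h) c)                                           ≡⟨ cong δ (onCell-∘ g h c) ⟩
  δ (onCell g (onCell h c))                                       ≡⟨ I (onCell h c) ⟩
  act (handed g Sign.* s) (δ (onCell h c))                        ≡⟨ cong (act (handed g Sign.* s)) (J c) ⟩
  act (handed g Sign.* s) (act (handed h Sign.* t) (δ c))         ≡⟨ act-* (handed g Sign.* s) _ (δ c) ⟨
  act ((handed g Sign.* s) Sign.* (handed h Sign.* t)) (δ c)
    ≡⟨ cong (λ σ → act σ (δ c)) (interchange Sign.*-commutativeSemigroup (handed g) s (handed h) t) ⟩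
  act ((handed g Sign.* handed h) Sign.* (s Sign.* t)) (δ c)
    ≡⟨ cong (λ σ → act (σ Sign.* (s Sign.* t)) (δ c)) (handed-∘ g h) ⟨
  act (handed (g ∘ⁱ h) Sign.* (s Sign.* t)) (δ c)                 ∎
  where open ≡-Reasoning

invariant-unit : ∀ δ → Invariant δ unit
invariant-unit δ (i , j) = cong₂ (λ x y → δ (x , y)) (ℤ.+-identityʳ i) (ℤ.+-identityʳ j)

invariant-⁻¹ : ∀ δ m → Invariant δ m → Invariant δ (m ⁻¹)
invariant-⁻¹ δ (g , s) I c = begin
  δ (onCell (invⁱ g) c)                    ≡⟨ act-involutive σ _ ⟨
  act σ (act σ (δ (onCell (invⁱ g) c)))    ≡⟨ cong (act σ) (I (onCell (invⁱ g) c)) ⟨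
  act σ (δ (onCell g (onCell (invⁱ g) c))) ≡⟨ cong (act σ ∘ δ) (onCell-inv g c) ⟩
  act σ (δ c)                              ≡⟨ cong (λ h → act (h Sign.* s) (δ c)) (handed-inv g) ⟨
  act (handed (invⁱ g) Sign.* s) (δ c)     ∎
  where
  open ≡-Reasoning
  σ = handed g Sign.* s

-- Crossings along a strand

cross : Strand → ℤ → Strand
cross (warp _) j = weft j
cross (weft _) i = warp i

index : Strand → ℤ
index (warp i) = i
index (weft j) = j

-- Dark means that the given strand is on top, be it a warp or a weft, so that scores treat both
-- directions alike.
beats : Design → Strand → ℤ → Colour
beats δ (warp i) j = δ (i , j)
beats δ (weft j) i = opp (δ (i , j))

cross-cross : ∀ s k → cross (cross s k) (index s) ≡ s
cross-cross (warp _) _ = refl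
cross-cross (weft _) _ = refl

index-cross : ∀ s k → index (cross s k) ≡ k
index-cross (warp _) _ = refl
index-cross (weft _) _ = refl

beats-cross : ∀ δ s k → beats δ (cross s k) (index s) ≡ opp (beats δ s k)
beats-cross δ (warp i) j = refl
beats-cross δ (weft j) i = sym (opp-involutive _)

beats-opp : ∀ δ s k → beats (opp ∘ δ) s k ≡ opp (beats δ s k)
beats-opp δ (warp _) _ = refl
beats-opp δ (weft _) _ = refl

along : Isometry → Strand → LineIsometry
along (straight X Y) (warp _) = Y
along (straight X Y) (weft _) = X
along (crossed X Y)  (warp _) = X
along (crossed X Y)  (weft _) = Y

-- As `beats` is relative to the strand, it absorbs the exchange of warps and wefts; only the
-- reversal of sides remains as a sign.
beats-invariant : ∀ δ g s → Invariant δ (g , s) → ∀ z k →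
  beats δ (onStrand g z) (onInterval (along g z) k) ≡ act s (beats δ z k)
beats-invariant δ (straight X Y) s I (warp i) k = I (i , k)
beats-invariant δ (straight X Y) e I (weft j) k = cong opp (I (k , j))
beats-invariant δ (straight X Y) τ I (weft j) k = cong opp (I (k , j))
beats-invariant δ (crossed X Y) e I (warp i) k =
  trans (cong opp (I (i , k))) (opp-involutive _)
beats-invariant δ (crossed X Y) τ I (warp i) k = cong opp (I (i , k))
beats-invariant δ (crossed X Y) e I (weft j) k = I (k , j)
beats-invariant δ (crossed X Y) τ I (weft j) k =
  trans (I (k , j)) (sym (opp-involutive _))

-- Induction on the integers

ℤ-induction : ∀ {ℓ} (Q : ℤ → Set ℓ) → Q 0ℤ →
  (∀ k → Q k → Q (k + 1ℤ)) → (∀ k → Q (k + 1ℤ) → Q k) → ∀ k → Q k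
ℤ-induction Q z up down (+ n) = ascend n
  where
  ascend : ∀ n → Q (+ n)
  ascend zero    = z
  ascend (suc n) = subst (Q ∘ +_) (ℕ.+-comm n 1) (up (+ n) (ascend n))
ℤ-induction Q z up down -[1+ n ] = descend n
  where
  descend : ∀ n → Q -[1+ n ]
  descend zero    = down -[1+ 0 ] z
  descend (suc n) = down -[1+ suc n ] (descend n)

module _ {A : Set} where

  constant-from-0 : (f : ℤ → A) → (∀ k → f (k + 1ℤ) ≡ f k) → ∀ k → f k ≡ f 0ℤ
  constant-from-0 f step = ℤ-induction (λ k → f k ≡ f 0ℤ) refl
    (λ k → trans (step k)) (λ k → trans (sym (step k)))

  periodic-* : ∀ (f : ℤ → A) m → (∀ i → f (i + m) ≡ f i) → ∀ k i → f (i + k * m) ≡ f i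
  periodic-* f m step k i = trans (constant-from-0 (λ l → f (i + l * m)) next k)
                                  (cong f (base i m))
    where
    base : ∀ i m → i + 0ℤ * m ≡ i
    base = solve-∀
    assoc : ∀ i l m → i + (l + 1ℤ) * m ≡ i + l * m + m
    assoc = solve-∀
    next : ∀ l → f (i + (l + 1ℤ) * m) ≡ f (i + l * m)
    next l = trans (cong f (assoc i l m)) (step (i + l * m))

  -- Two consecutive values determine such a function.
  two-step-unique : ∀ (φ : A → A) → (∀ x → φ (φ x) ≡ x) → ∀ (f g : ℤ → A) c →
    (∀ i → f (i + + 2) ≡ φ (f i)) → (∀ i → g (i + + 2) ≡ φ (g i)) →
    f (c - 1ℤ) ≡ g (c - 1ℤ) → f c ≡ g c → ∀ i → f i ≡ g i
  two-step-unique φ inv f g c f₂ g₂ eq₋ eq₀ i =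
    subst (λ k → f k ≡ g k) (cancel c i) (proj₂ (both (i - c)))
    where
    cancel : ∀ c i → c + (i - c) ≡ i
    cancel = solve-∀
    at-0 : ∀ c → c + 0ℤ ≡ c
    at-0 = solve-∀
    at₋-0 : ∀ c → c - 1ℤ + 0ℤ ≡ c - 1ℤ
    at₋-0 = solve-∀
    same : ∀ c k → c - 1ℤ + (k + 1ℤ) ≡ c + k
    same = solve-∀
    two : ∀ c k → c + (k + 1ℤ) ≡ c - 1ℤ + k + + 2
    two = solve-∀
    -- The recurrence has order two, so the induction carries two consecutive values.
    Q : ℤ → Set
    Q k = f (c - 1ℤ + k) ≡ g (c - 1ℤ + k) × f (c + k) ≡ g (c + k)
    φ-injective : ∀ {x y} → φ x ≡ φ y → x ≡ y
    φ-injective {x} {y} eq = trans (sym (inv x)) (trans (cong φ eq) (inv y))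
    up : ∀ k → Q k → Q (k + 1ℤ)
    up k (p , q) = subst (λ z → f z ≡ g z) (sym (same c k)) q ,
      subst (λ z → f z ≡ g z) (sym (two c k))
        (trans (f₂ _) (trans (cong φ p) (sym (g₂ _))))
    down : ∀ k → Q (k + 1ℤ) → Q k
    down k (p , q) = φ-injective (trans (sym (f₂ _))
      (trans (subst (λ z → f z ≡ g z) (two c k) q) (g₂ _))) ,
      subst (λ z → f z ≡ g z) (same c k) p
    both : ∀ k → Q k
    both = ℤ-induction Q
      (subst (λ z → f z ≡ g z) (sym (at₋-0 c)) eq₋ ,
       subst (λ z → f z ≡ g z) (sym (at-0 c)) eq₀) up down

-- Counting dark values

dark? : Colour → ℕ
dark? dark = 1
dark? pale = 0

count : ℕ → (ℤ → Colour) → ℕ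
count zero    f = 0
count (suc n) f = dark? (f (+ n)) ℕ.+ count n f

count-cong : ∀ n {f g} → (∀ i → f i ≡ g i) → count n f ≡ count n g
count-cong zero    eq = refl
count-cong (suc n) eq = cong₂ ℕ._+_ (cong dark? (eq (+ n))) (count-cong n eq)

count-opp : ∀ n f → count n (opp ∘ f) ℕ.+ count n f ≡ n
count-opp zero    f = refl
count-opp (suc n) f with f (+ n)
... | dark = trans (ℕ.+-suc _ _) (cong suc (count-opp n f))
... | pale = cong suc (count-opp n f)

count-dark : ∀ n → count n (λ _ → dark) ≡ n
count-dark zero    = refl
count-dark (suc n) = cong suc (count-dark n)

count-mono : ∀ n f g → (∀ k → k ℕ.< n → f (+ k) ≡ dark → g (+ k) ≡ dark) →
  count n f ℕ.≤ count n g
count-mono zero    f g f⇒g = ℕ.z≤n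
count-mono (suc n) f g f⇒g with f (+ n) | g (+ n) | f⇒g n ℕ.≤-refl
                              | count-mono n f g (λ k k<n → f⇒g k (ℕ.m<n⇒m<1+n k<n))
... | dark | dark | _ | ih = ℕ.s≤s ih
... | dark | pale | h | _  = contradiction (h refl) λ ()
... | pale | dark | _ | ih = ℕ.m≤n⇒m≤1+n ih
... | pale | pale | _ | ih = ih

count-≤ : ∀ n f → count n f ℕ.≤ n
count-≤ n f = subst (count n f ℕ.≤_) (count-dark n) (count-mono n f _ λ _ _ _ → refl)

-- A finite set that lies in another one with no more elements is equal to it.
count-tight : ∀ n f g → (∀ k → k ℕ.< n → f (+ k) ≡ dark → g (+ k) ≡ dark) →
  count n g ℕ.≤ count n f → ∀ k → k ℕ.< n → g (+ k) ≡ dark → f (+ k) ≡ dark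
count-tight (suc n) f g f⇒g le k k<1+n gk
  with ℕ.m<1+n⇒m<n∨m≡n k<1+n | f (+ n) in fn | g (+ n) in gn
     | f⇒g n ℕ.≤-refl | count-mono n f g (λ l l<n → f⇒g l (ℕ.m<n⇒m<1+n l<n))
... | inj₂ refl | dark | _    | _ | _ = fn
... | inj₂ refl | pale | dark | _ | m = contradiction le (ℕ.<⇒≱ (ℕ.s≤s m))
... | inj₂ refl | pale | pale | _ | _ = contradiction (trans (sym gn) gk) λ ()
... | inj₁ k<n  | dark | dark | _ | _ =
  count-tight n f g (λ l l<n → f⇒g l (ℕ.m<n⇒m<1+n l<n)) (ℕ.s≤s⁻¹ le) k k<n gk
... | inj₁ k<n  | dark | pale | h | _ = contradiction (h refl) λ ()
... | inj₁ k<n  | pale | dark | _ | m = contradiction le (ℕ.<⇒≱ (ℕ.s≤s m))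
... | inj₁ k<n  | pale | pale | _ | _ =
  count-tight n f g (λ l l<n → f⇒g l (ℕ.m<n⇒m<1+n l<n)) le k k<n gk

count-full : ∀ n f → (∀ k → k ℕ.< n → f (+ k) ≡ dark) → count n f ≡ n
count-full n f h = ℕ.≤-antisym (count-≤ n f)
  (subst (ℕ._≤ count n f) (count-dark n) (count-mono n _ f λ k k<n _ → h k k<n))

count-full⁻¹ : ∀ n f → count n f ≡ n → ∀ k → k ℕ.< n → f (+ k) ≡ dark
count-full⁻¹ n f eq k k<n = count-tight n f (λ _ → dark) (λ _ _ _ → refl)
  (ℕ.≤-reflexive (trans (count-dark n) (sym eq))) k k<n refl

count-<⇒∃pale : ∀ n f → count n f ℕ.< n → ∃[ k ] k ℕ.< n × f (+ k) ≡ pale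
count-<⇒∃pale (suc n) f lt with f (+ n) in eq
... | pale = n , ℕ.≤-refl , eq
... | dark with count-<⇒∃pale n f (ℕ.s≤s⁻¹ lt)
...   | k , k<n , fk = k , ℕ.m<n⇒m<1+n k<n , fk

-- `count` peels off the last position, whereas shifts and reversals need to peel off the first.
count-front : ∀ n f → count (suc n) f ≡ dark? (f 0ℤ) ℕ.+ count n (λ i → f (1ℤ + i))
count-front zero    f = refl
count-front (suc n) f = trans (cong (dark? (f (+ suc n)) ℕ.+_) (count-front n f))
  (swap (dark? (f (+ suc n))) (dark? (f 0ℤ)) _)
  where
  swap : ∀ a b c → a ℕ.+ (b ℕ.+ c) ≡ b ℕ.+ (a ℕ.+ c)
  swap a b c = trans (sym (ℕ.+-assoc a b c))
    (trans (cong (ℕ._+ c) (ℕ.+-comm a b)) (ℕ.+-assoc b a c))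

count-shift : ∀ N f → (∀ i → f (i + + N) ≡ f i) → ∀ k →
  count N (λ i → f (i + k)) ≡ count N f
count-shift N f per k = trans
  (constant-from-0 (λ l → count N (λ i → f (i + l))) next k)
  (count-cong N (λ i → cong f (ℤ.+-identityʳ i)))
  where
  exchange : ∀ i l n → i + n + l ≡ i + l + n
  exchange = solve-∀
  regroup : ∀ i l → i + (l + 1ℤ) ≡ 1ℤ + i + l
  regroup = solve-∀
  -- Moving the window by one loses the value at 0 and gains the equal value at `+ N`.
  one : ∀ g → g (+ N) ≡ g 0ℤ → count N (λ i → g (1ℤ + i)) ≡ count N g
  one g eq = ℕ.+-cancelˡ-≡ (dark? (g 0ℤ)) _ _
    (trans (sym (count-front N g)) (cong (λ x → dark? x ℕ.+ count N g) eq))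
  next : ∀ l → count N (λ i → f (i + (l + 1ℤ))) ≡ count N (λ i → f (i + l))
  next l = trans (count-cong N (λ i → cong f (regroup i l)))
    (one (λ i → f (i + l)) (trans (cong f (exchange 0ℤ l (+ N))) (per (0ℤ + l))))

count-reverse : ∀ n f → count n (λ i → f (+ n - (i + 1ℤ))) ≡ count n f
count-reverse zero    f = refl
count-reverse (suc n) f = begin
  dark? (f (+ suc n - (+ n + 1ℤ))) ℕ.+ count n (λ i → f (+ suc n - (i + 1ℤ)))
    ≡⟨ cong₂ ℕ._+_ (cong (dark? ∘ f) (first (+ n))) (count-cong n (λ i → cong f (rest (+ n) i))) ⟩
  dark? (f 0ℤ) ℕ.+ count n (λ i → f (1ℤ + (+ n - (i + 1ℤ))))
    ≡⟨ cong (dark? (f 0ℤ) ℕ.+_) (count-reverse n (λ i → f (1ℤ + i))) ⟩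
  dark? (f 0ℤ) ℕ.+ count n (λ i → f (1ℤ + i))
    ≡⟨ count-front n f ⟨
  count (suc n) f ∎
  where
  open ≡-Reasoning
  first : ∀ m → (1ℤ + m) - (m + 1ℤ) ≡ 0ℤ
  first = solve-∀
  rest : ∀ m i → (1ℤ + m) - (i + 1ℤ) ≡ 1ℤ + (m - (i + 1ℤ))
  rest = solve-∀

-- A flip is a reversal of the window of length `N` combined with a shift.
count-onInterval : ∀ N f → (∀ i → f (i + + N) ≡ f i) → ∀ X →
  count N (f ∘ onInterval X) ≡ count N f
count-onInterval N f per (shift t) = count-shift N f per t
count-onInterval N f per (flip t)  = begin
  count N (λ i → f (t - (i + 1ℤ)))                ≡⟨ count-cong N (λ i → cong f (regroup (+ N) t i)) ⟩
  count N (λ i → f (+ N - (i + 1ℤ) + (t - + N)))  ≡⟨ count-reverse N (λ i → f (i + (t - + N))) ⟩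
  count N (λ i → f (i + (t - + N)))               ≡⟨ count-shift N f per (t - + N) ⟩
  count N f ∎
  where
  open ≡-Reasoning
  regroup : ∀ n t i → t - (i + 1ℤ) ≡ n - (i + 1ℤ) + (t - n)
  regroup = solve-∀

-- Scores and cuts

score : ℕ → Design → Strand → ℕ
score N δ s = count N (beats δ s)

PeriodicBy : ℕ → Design → Set
PeriodicBy N δ = (∀ i j → δ (i + + N , j) ≡ δ (i , j)) × (∀ i j → δ (i , j + + N) ≡ δ (i , j))

beats-periodic : ∀ {N δ} → PeriodicBy N δ → ∀ s k → beats δ s (k + + N) ≡ beats δ s k
beats-periodic (_ , per) (warp i) k = per i k
beats-periodic (per , _) (weft j) k = cong opp (per k j)

-- The motion carries the crossings on `z` to those on its image by an isometry of the line, which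
-- does not change a count over a period.
score-onStrand : ∀ {N δ} → PeriodicBy N δ → ∀ g s → Invariant δ (g , s) → ∀ z →
  score N δ (onStrand g z) ≡ count N (act s ∘ beats δ z)
score-onStrand {N} {δ} per g s I z = trans
  (sym (count-onInterval N (beats δ (onStrand g z))
    (beats-periodic per (onStrand g z)) (along g z)))
  (count-cong N (beats-invariant δ g s I z))

score-opp : ∀ N δ s → score N (opp ∘ δ) s ℕ.+ score N δ s ≡ N
score-opp N δ s = trans (cong (ℕ._+ score N δ s) (count-cong N (beats-opp δ s)))
  (count-opp N (beats δ s))

Cut : Design → (Strand → Bool) → Set
Cut δ A = ∀ s k → A s ≡ true → A (cross s k) ≡ false → beats δ s k ≡ dark

fallsApart⇒cut : ∀ P → ((A , _) : FallsApart P) → Cut (design P) A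
fallsApart⇒cut P (A , _ , _ , above) (warp i) k As At
  with design P (i , k) | above (i , k)
... | dark | _ = refl
... | pale | h = contradiction
  (trans (sym At) (h λ eq → contradiction (trans (sym At) (trans eq As)) λ ())) λ ()
fallsApart⇒cut P (A , _ , _ , above) (weft j) k As At
  with design P (k , j) | above (k , j)
... | pale | _ = refl
... | dark | h = contradiction
  (trans (sym At) (h λ eq → contradiction (trans (sym At) (trans eq As)) λ ())) λ ()

-- Seen from the reverse side, the lower part of the partition is the upper one.
cut-opp : ∀ δ A → Cut δ A → Cut (opp ∘ δ) (not ∘ A)
cut-opp δ A cut s k As At = trans (beats-opp δ s k) (trans (sym (beats-cross δ s k))
  (cut (cross s k) (index s) (not-injective At)
    (trans (cong A (cross-cross s k)) (not-injective As))))

parallel-or-crossing : ∀ s x →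
  (∀ k → cross x k ≡ cross s k) ⊎ (∀ m k → cross (cross x m) k ≡ cross s k)
parallel-or-crossing (warp _) (warp _) = inj₁ λ _ → refl
parallel-or-crossing (warp _) (weft _) = inj₂ λ _ _ → refl
parallel-or-crossing (weft _) (warp _) = inj₂ λ _ _ → refl
parallel-or-crossing (weft _) (weft _) = inj₁ λ _ → refl

-- Suppose s is below.  A strand above and parallel to s beats all strands
-- below that cross it; as its score does not exceed that of s, which only
-- beats such strands, it beats nothing else.  Hence a strand above that crosses
-- s beats everything and has score N.
module _ (N : ℕ) (δ : Design) (A : Strand → Bool) (cut : Cut δ A) (s : Strand)
         (max : ∀ x → score N δ x ℕ.≤ score N δ s) (D<N : score N δ s ℕ.< N) where

  private module _ (As : A s ≡ false) where

    -- Encoded as a colour so that `count` applies.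
    below : ℤ → Colour
    below k = if A (cross s k) then pale else dark

    below-dark⁻¹ : ∀ k → below k ≡ dark → A (cross s k) ≡ false
    below-dark⁻¹ k eq with A (cross s k)
    ... | false = refl
    below-dark⁻¹ k () | true

    below-pale⁻¹ : ∀ k → below k ≡ pale → A (cross s k) ≡ true
    below-pale⁻¹ k eq with A (cross s k)
    ... | true = refl
    below-pale⁻¹ k () | false

    s-beats⇒below : ∀ k → beats δ s k ≡ dark → below k ≡ dark
    s-beats⇒below k bs with A (cross s k) in At
    ... | false = refl
    ... | true  = contradiction
      (trans (sym (cut (cross s k) (index s) At (trans (cong A (cross-cross s k)) As)))
        (trans (beats-cross δ s k) (cong opp bs))) λ ()

    module _ (x : Strand) (par : ∀ k → cross x k ≡ cross s k) (Ax : A x ≡ true) where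

      below⇒x-beats : ∀ k → below k ≡ dark → beats δ x k ≡ dark
      below⇒x-beats k o = cut x k Ax (trans (cong A (par k)) (below-dark⁻¹ k o))

      x-beats⇒below : ∀ k → k ℕ.< N → beats δ x (+ k) ≡ dark → below (+ k) ≡ dark
      x-beats⇒below = count-tight N below (beats δ x) (λ k _ → below⇒x-beats (+ k))
        (ℕ.≤-trans (max x) (count-mono N _ _ λ k _ → s-beats⇒below (+ k)))

      -- If all strands crossing `s` in the period were below, `x` would beat them all and have
      -- score `N`, more than the maximum.
      some-above : ∃[ k ] k ℕ.< N × below (+ k) ≡ pale
      some-above = count-<⇒∃pale N below (ℕ.≤-<-trans
        (ℕ.≤-trans (count-mono N _ _ λ k _ → below⇒x-beats (+ k)) (max x)) D<N)

    parallel-below : ∀ x → (∀ k → cross x k ≡ cross s k) → ¬ (A x ≡ true)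
    parallel-below x par Ax with some-above x par Ax
    ... | k , k<N , ok = ℕ.<-irrefl refl (ℕ.<-≤-trans D<N
        (subst (ℕ._≤ score N δ s) (count-full N (beats δ t) λ m _ → t-beats m) (max t)))
      where
      t = cross s (+ k)
      At : A t ≡ true
      At = below-pale⁻¹ (+ k) ok
      t-beats : ∀ m → beats δ t (+ m) ≡ dark
      t-beats m with A (cross t (+ m)) in Ay | beats δ t (+ m) in bt
      ... | _     | dark = refl
      ... | false | pale = contradiction (trans (sym bt) (cut t (+ m) At Ay)) λ ()
      -- The strand crossing `t` here is above and parallel to `s`, so it beats only strands below;
      -- hence it cannot beat `t`, which is above.
      ... | true  | pale = contradiction (trans (sym ok)
          (x-beats⇒below (cross t (+ m)) (λ l → same-cross l) Ay k k<N y-beats)) λ ()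
        where
        same-cross : ∀ l → cross (cross t (+ m)) l ≡ cross s l
        same-cross l = helper s
          where
          helper : ∀ s → cross (cross (cross s (+ k)) (+ m)) l ≡ cross s l
          helper (warp _) = refl
          helper (weft _) = refl
        y-beats : beats δ (cross t (+ m)) (+ k) ≡ dark
        y-beats = trans
          (cong (beats δ (cross t (+ m))) (sym (index-cross s (+ k))))
          (trans (beats-cross δ t (+ m)) (cong opp bt))

  maximal-above : (∃[ x ] A x ≡ true) → A s ≡ true
  maximal-above (a , Aa) with A s in As
  ... | true  = refl
  ... | false with parallel-or-crossing s a
  ...   | inj₁ par = contradiction Aa (parallel-below As a par)
  -- The strands crossing `a` are parallel to `s`, hence all below, so `a` beats them all and has
  -- score `N`.
  ...   | inj₂ cr  = contradiction D<N (ℕ.≤⇒≯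
    (subst (ℕ._≤ score N δ s) (count-full N (beats δ a) λ k _ → a-beats (+ k)) (max a)))
    where
    a-beats : ∀ k → beats δ a k ≡ dark
    a-beats k with A (cross a k) in Ay
    ... | false = cut a k Aa Ay
    ... | true  = contradiction Ay (parallel-below As (cross a k) (cr k))

-- If scores are equal, every strand has the maximal score, and `maximal-above` would place even the
-- strands of the lower part in the upper one. The common score is less than `N`, since warp 0 and
-- weft 0 cannot both be on top where they cross.
equal-scores-no-cut : ∀ N δ A → 0 ℕ.< N → Cut δ A →
  (∃[ x ] A x ≡ true) → (∃[ x ] A x ≡ false) → ¬ (∀ s t → score N δ s ≡ score N δ t)
equal-scores-no-cut N δ A 0<N cut above (s , As) equal =
  contradiction (trans (sym As) (maximal-above N δ A cut s
    (λ x → ℕ.≤-reflexive (equal x s)) (ℕ.≤∧≢⇒< (count-≤ N _) not-full) above)) λ ()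
  where
  not-full : score N δ s ≢ N
  not-full eq = contradiction
    (trans (sym (cong opp (dark-at-0 (warp 0ℤ)))) (dark-at-0 (weft 0ℤ))) λ ()
    where
    dark-at-0 : ∀ t → beats δ t 0ℤ ≡ dark
    dark-at-0 t = count-full⁻¹ N (beats δ t) (trans (equal t s) eq) 0 0<N

-- Levels

-- Compares `d` with half of `N`. A tie counts as pale, but `D-unbalanced` excludes ties between a
-- score and its complement.
balance : ℕ → ℕ → Colour
balance N d = if N ℕ.<ᵇ d ℕ.+ d then dark else pale

balance-dark : ∀ N d → N ℕ.< d ℕ.+ d → balance N d ≡ dark
balance-dark N d lt with N ℕ.<ᵇ d ℕ.+ d | ℕ.<⇒<ᵇ lt
... | true | _ = refl

balance-dark⁻¹ : ∀ N d → balance N d ≡ dark → N ℕ.< d ℕ.+ d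
balance-dark⁻¹ N d eq with N ℕ.<ᵇ d ℕ.+ d | ℕ.<ᵇ⇒< N (d ℕ.+ d)
... | true | h = h _
balance-dark⁻¹ N d () | false | _

balance-swap : ∀ N a b → a ℕ.+ b ≡ N → a ≢ b → balance N a ≡ opp (balance N b)
balance-swap N a b refl a≢b with ℕ.<-cmp a b
... | tri< a<b _ _ = trans (not-dark a b a<b) (cong opp (sym (balance-dark N b (ℕ.+-monoˡ-< b a<b))))
  where
  not-dark : ∀ a b → a ℕ.< b → balance (a ℕ.+ b) a ≡ pale
  not-dark a b a<b with balance (a ℕ.+ b) a in eq
  ... | pale = refl
  ... | dark = contradiction (ℕ.+-monoʳ-< a a<b) (ℕ.<-asym (balance-dark⁻¹ (a ℕ.+ b) a eq))
... | tri≈ _ a≡b _ = contradiction a≡b a≢b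
... | tri> _ _ b<a = trans (balance-dark N a (ℕ.+-monoʳ-< a b<a)) (cong opp (sym not-dark))
  where
  not-dark : balance N b ≡ pale
  not-dark with balance N b in eq
  ... | pale = refl
  ... | dark = contradiction (ℕ.+-monoˡ-< b b<a) (ℕ.<-asym (balance-dark⁻¹ N b eq))

module Levels (N : ℕ) (0<N : 0 ℕ.< N) (δ : Design) (periodic : PeriodicBy N δ)
  (transitive : ∀ s t → ∃[ m ] Invariant δ m × onStrand (proj₁ m) s ≡ t)
  (A : Strand → Bool) (cut : Cut δ A)
  (above : ∃[ x ] A x ≡ true) (below : ∃[ x ] A x ≡ false) where

  D : Strand → ℕ
  D = score N δ

  level : Strand → Colour
  level s = balance N (D s)

  D-e : ∀ g → Invariant δ (g , e) → ∀ z → D (onStrand g z) ≡ D z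
  D-e g = score-onStrand periodic g e

  D-τ : ∀ g → Invariant δ (g , τ) → ∀ z → D (onStrand g z) ℕ.+ D z ≡ N
  D-τ g I z = trans (cong (ℕ._+ D z) (score-onStrand periodic g τ I z)) (count-opp N (beats δ z))

  -- A symmetry without `τ` preserves scores and one with `τ` complements them; by transitivity one
  -- of either kind carries `s` to `t`.
  D-dichotomy : ∀ s t → D t ≡ D s ⊎ D t ℕ.+ D s ≡ N
  D-dichotomy s t with transitive s t
  ... | (g , e) , I , refl = inj₁ (D-e g I s)
  ... | (g , τ) , I , refl = inj₂ (D-τ g I s)

  D-not-constant : ¬ (∀ s t → D s ≡ D t)
  D-not-constant = equal-scores-no-cut N δ A 0<N cut above below

  -- For a score of exactly half of `N` the two alternatives of `D-dichotomy` coincide, so all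
  -- scores would be equal.
  D-unbalanced : ∀ s → D s ℕ.+ D s ≢ N
  D-unbalanced s eq = D-not-constant λ t u → trans (same t) (sym (same u))
    where
    same : ∀ t → D t ≡ D s
    same t with D-dichotomy s t
    ... | inj₁ h = h
    ... | inj₂ h = ℕ.+-cancelʳ-≡ (D s) (D t) (D s) (trans h (sym eq))

  level-opp : ∀ s t → D s ℕ.+ D t ≡ N → level s ≡ opp (level t)
  level-opp s t eq = balance-swap N (D s) (D t) eq
    λ Ds≡Dt → D-unbalanced t (trans (cong (ℕ._+ D t) (sym Ds≡Dt)) eq)

  level-onStrand : ∀ g s → Invariant δ (g , s) → ∀ z → level (onStrand g z) ≡ act s (level z)
  level-onStrand g e I z = cong (balance N) (D-e g I z)
  level-onStrand g τ I z = level-opp (onStrand g z) z (D-τ g I z)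

  level-not-constant : ¬ (∀ s t → level s ≡ level t)
  level-not-constant h = D-not-constant same
    where
    same : ∀ s t → D s ≡ D t
    same s t with D-dichotomy t s
    ... | inj₁ eq = eq
    ... | inj₂ eq = contradiction (trans (sym (level-opp s t eq)) (h s t)) opp≢

  level-differ : ∀ s t → level s ≡ dark → level t ≡ pale → D t ℕ.+ D s ≡ N
  level-differ s t ls lt with D-dichotomy s t
  ... | inj₂ eq = eq
  ... | inj₁ eq = contradiction (trans (sym lt) (trans (cong (balance N) eq) ls)) λ ()

  level-dark-max : ∀ s → level s ≡ dark → ∀ x → D x ℕ.≤ D s
  level-dark-max s ls x with D-dichotomy s x
  ... | inj₁ eq = ℕ.≤-reflexive eq
  ... | inj₂ eq = ℕ.<⇒≤ (ℕ.+-cancelʳ-< (D s) (D x) (D s)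
    (subst (ℕ._< D s ℕ.+ D s) (sym eq) (balance-dark⁻¹ N (D s) ls)))

  level-pale-min : ∀ s → level s ≡ pale → ∀ x → D s ℕ.≤ D x
  level-pale-min s ls x with level x in lx
  ... | dark = level-dark-max x lx s
  ... | pale with D-dichotomy x s
  ...   | inj₁ eq = ℕ.≤-reflexive eq
  ...   | inj₂ eq = contradiction (trans (sym ls) (trans (level-opp s x eq) (cong opp lx))) λ ()

  -- A dark strand has maximal score, so unless it beats everything it is in the upper part of the
  -- cut. In the opposite design the pale strand has maximal score, which puts it in the lower part.
  dark-beats-pale : ∀ s k → level s ≡ dark → level (cross s k) ≡ pale → beats δ s k ≡ dark
  dark-beats-pale s k ls lt with ℕ.m≤n⇒m<n∨m≡n (count-≤ N (beats δ s))
  -- `count-full⁻¹` speaks only of the positions from 0 to `N - 1`; shifting by `k` moves the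
  -- crossing in question to 0.
  ... | inj₂ full = subst (λ l → beats δ s l ≡ dark) (ℤ.+-identityˡ k)
    (count-full⁻¹ N (λ i → beats δ s (i + k))
      (trans (count-shift N (beats δ s) (beats-periodic periodic s) k) full) 0 0<N)
  ... | inj₁ D<N = cut s k
    (maximal-above N δ A cut s (level-dark-max s ls) D<N above)
    (not-injective (maximal-above N (opp ∘ δ) (not ∘ A) (cut-opp δ A cut) t max′ D′<N
      (proj₁ below , cong not (proj₂ below))))
    where
    t = cross s k
    sum : ∀ x → score N (opp ∘ δ) x ℕ.+ D x ≡ N
    sum = score-opp N δ
    max′ : ∀ x → score N (opp ∘ δ) x ℕ.≤ score N (opp ∘ δ) t
    max′ x = ℕ.+-cancelʳ-≤ (D t) _ _ (ℕ.≤-trans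
      (ℕ.+-monoʳ-≤ (score N (opp ∘ δ) x) (level-pale-min t lt x))
      (ℕ.≤-reflexive (trans (sum x) (sym (sum t)))))
    D′≡ : score N (opp ∘ δ) t ≡ D s
    D′≡ = ℕ.+-cancelʳ-≡ (D t) _ _ (trans (sum t)
      (trans (sym (level-differ s t ls lt)) (ℕ.+-comm (D t) (D s))))
    D′<N : score N (opp ∘ δ) t ℕ.< N
    D′<N = subst (ℕ._< N) (sym D′≡) D<N

-- Periods

module _ (δ : Design) (u₁ u₂ : ℤ) (period : ∀ i j → δ (i + u₁ , j + u₂) ≡ δ (i , j)) where

  period-* : ∀ k i j → δ (i + k * u₁ , j + k * u₂) ≡ δ (i , j)
  period-* k i j = trans (constant-from-0 (λ l → δ (i + l * u₁ , j + l * u₂)) next k)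
    (cong₂ (λ x y → δ (x , y)) (at-0 i u₁) (at-0 j u₂))
    where
    at-0 : ∀ i m → i + 0ℤ * m ≡ i
    at-0 = solve-∀
    at-suc : ∀ i l m → i + (l + 1ℤ) * m ≡ i + l * m + m
    at-suc = solve-∀
    next : ∀ l → δ (i + (l + 1ℤ) * u₁ , j + (l + 1ℤ) * u₂) ≡ δ (i + l * u₁ , j + l * u₂)
    next l = trans (cong₂ (λ x y → δ (x , y)) (at-suc i l u₁) (at-suc j l u₂)) (period _ _)

square-abs : ∀ d → + (∣ d ∣ ℕ.* ∣ d ∣) ≡ d * d
square-abs (+ n)    = ℤ.pos-* n n
square-abs -[1+ n ] = refl

-- Cramer's rule: v₂ u - u₂ v and u₁ v - v₁ u are (d , 0) and (0 , d).  The
-- factor 2d makes the period even and positive.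
even-period : ∀ δ → Periodic δ → ∃[ n ] 0 ℕ.< n × PeriodicBy (n ℕ.+ n) δ
even-period δ ((u₁ , u₂) , (v₁ , v₂) , d≢0 , u-period , v-period) =
  ∣ d ∣ ℕ.* ∣ d ∣ , positive ,
  (λ i j → trans (cong₂ (λ x y → δ (x , y))
      (trans (cong (λ z → i + z) N≡) (x-period i u₁ u₂ v₁ v₂ (d + d))) (y-fixed j u₂ v₂ (d + d)))
    (combine ((d + d) * v₂) (- ((d + d) * u₂)) i j)) ,
  (λ i j → trans (cong₂ (λ x y → δ (x , y))
      (x-fixed i u₁ v₁ (d + d)) (trans (cong (λ z → j + z) N≡) (y-period j u₁ u₂ v₁ v₂ (d + d))))
    (combine (- ((d + d) * v₁)) ((d + d) * u₁) i j))
  where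
  d = u₁ * v₂ - u₂ * v₁
  positive : 0 ℕ.< ∣ d ∣ ℕ.* ∣ d ∣
  positive with ∣ d ∣ | ℤ.∣i∣≡0⇒i≡0 {d}
  ... | zero  | h = contradiction (h refl) d≢0
  ... | suc _ | _ = ℕ.s≤s ℕ.z≤n
  N≡ : + (∣ d ∣ ℕ.* ∣ d ∣ ℕ.+ ∣ d ∣ ℕ.* ∣ d ∣) ≡ (d + d) * d
  N≡ = trans (cong₂ _+_ (square-abs d) (square-abs d)) (sym (ℤ.*-distribʳ-+ d d d))
  combine : ∀ a b i j → δ (i + a * u₁ + b * v₁ , j + a * u₂ + b * v₂) ≡ δ (i , j)
  combine a b i j = trans (period-* δ v₁ v₂ v-period b _ _) (period-* δ u₁ u₂ u-period a i j)
  x-period : ∀ i u₁ u₂ v₁ v₂ m →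
    i + m * (u₁ * v₂ - u₂ * v₁) ≡ i + m * v₂ * u₁ + - (m * u₂) * v₁
  x-period = solve-∀
  y-period : ∀ j u₁ u₂ v₁ v₂ m →
    j + m * (u₁ * v₂ - u₂ * v₁) ≡ j + - (m * v₁) * u₂ + m * u₁ * v₂
  y-period = solve-∀
  y-fixed : ∀ j u₂ v₂ m → j ≡ j + m * v₂ * u₂ + - (m * u₂) * v₂
  y-fixed = solve-∀
  x-fixed : ∀ i u₁ v₁ m → i ≡ i + - (m * v₁) * u₁ + m * u₁ * v₁
  x-fixed = solve-∀

-- Parity

EvenOrOdd : ℤ → Set
EvenOrOdd k = (∃[ m ] k ≡ + 2 * m) ⊎ (∃[ m ] k ≡ + 2 * m + 1ℤ)

even-or-odd : ∀ k → EvenOrOdd k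
even-or-odd = ℤ-induction EvenOrOdd (inj₁ (0ℤ , refl)) up down
  where
  up₁ : ∀ m → + 2 * m + 1ℤ + 1ℤ ≡ + 2 * (m + 1ℤ)
  up₁ = solve-∀
  up : ∀ k → EvenOrOdd k → EvenOrOdd (k + 1ℤ)
  up _ (inj₁ (m , refl)) = inj₂ (m , refl)
  up _ (inj₂ (m , refl)) = inj₁ (m + 1ℤ , up₁ m)
  back : ∀ k → k ≡ k + 1ℤ - 1ℤ
  back = solve-∀
  down₁ : ∀ m → + 2 * m - 1ℤ ≡ + 2 * (m - 1ℤ) + 1ℤ
  down₁ = solve-∀
  down₂ : ∀ m → + 2 * m + 1ℤ - 1ℤ ≡ + 2 * m
  down₂ = solve-∀
  down : ∀ k → EvenOrOdd (k + 1ℤ) → EvenOrOdd k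
  down k (inj₁ (m , eq)) = inj₂ (m - 1ℤ , trans (back k) (trans (cong (_- 1ℤ) eq) (down₁ m)))
  down k (inj₂ (m , eq)) = inj₁ (m , trans (back k) (trans (cong (_- 1ℤ) eq) (down₂ m)))

divides-consecutive⇒divides-1 : ∀ d k → + d ∣ - k → + d ∣ k + 1ℤ → d ℕ.∣ 1
divides-consecutive⇒divides-1 d k d∣-k d∣k+1 = Signed.∣⇒∣ᵤ (subst (+ d Signed.∣_) (sum k)
  (Signed.∣m∣n⇒∣m+n (Signed.∣ᵤ⇒∣ {i = - k} d∣-k) (Signed.∣ᵤ⇒∣ {i = k + 1ℤ} d∣k+1)))
  where
  sum : ∀ k → - k + (k + 1ℤ) ≡ 1ℤ
  sum = solve-∀

-- The pair `(- k , k + 1)` will be half the difference of the centres of two quarter-turns of the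
-- fabric.
consecutive-coprime : ∀ k → Coprime (- k) (k + 1ℤ)
consecutive-coprime k {i} (i∣-k , i∣k+1) =
  ℕ.∣1⇒≡1 (divides-consecutive⇒divides-1 i k i∣-k i∣k+1)

2∤1 : ¬ (2 ℕ.∣ 1)
2∤1 d = contradiction (ℕ.∣⇒≤ d) λ { (ℕ.s≤s ()) }

consecutive-parity : ∀ k → OppositeParity (- k) (k + 1ℤ)
consecutive-parity k with even-or-odd k
... | inj₁ (m , refl) = inj₁ (even , 2∤1 ∘ divides-consecutive⇒divides-1 2 k even)
  where
  half : ∀ m → - (+ 2 * m) ≡ - m * + 2
  half = solve-∀
  even : + 2 ∣ - k
  even = Signed.∣⇒∣ᵤ (Signed.divides (- m) (half m))
... | inj₂ (m , refl) = inj₂ ((λ d → 2∤1 (divides-consecutive⇒divides-1 2 k d even)) , even)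
  where
  half : ∀ m → + 2 * m + 1ℤ + 1ℤ ≡ (m + 1ℤ) * + 2
  half = solve-∀
  even : + 2 ∣ k + 1ℤ
  even = Signed.∣⇒∣ᵤ (Signed.divides (m + 1ℤ) (half m))

parity : ℕ → Colour
parity zero    = dark
parity (suc n) = opp (parity n)

checker : ℤ → Colour
checker k = parity ∣ k ∣

checker-step : ∀ k → checker (k + 1ℤ) ≡ opp (checker k)
checker-step (+ zero)      = refl
checker-step (+ suc n)     = cong opp (checker-step (+ n))
checker-step -[1+ zero ]   = refl
checker-step -[1+ suc n ]  = sym (opp-involutive _)

checker-even : ∀ k m → checker (k + m * + 2) ≡ checker k
checker-even k m = periodic-* checker (+ 2) two m k
  where
  two-steps : ∀ i → i + + 2 ≡ i + 1ℤ + 1ℤ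
  two-steps = solve-∀
  two : ∀ i → checker (i + + 2) ≡ checker i
  two i = trans (cong checker (two-steps i)) (trans (checker-step (i + 1ℤ))
    (trans (cong opp (checker-step i)) (opp-involutive _)))

-- Stripes

pairs-step : ∀ p i → pairs p (i + + 2) ≡ opp (pairs p i)
pairs-step p i = trans (cong stripe (move p i)) (residue (i - p))
  where
  move : ∀ p i → i + + 2 - p ≡ i - p + + 2
  move = solve-∀
  stripe : ℤ → Colour
  stripe k = if k %ℕ 4 ℕ.<ᵇ 2 then dark else pale
  residue⁺ : ∀ n → stripe (+ n + + 2) ≡ opp (stripe (+ n))
  residue⁺ 0 = refl
  residue⁺ 1 = refl
  residue⁺ 2 = refl
  residue⁺ 3 = refl
  residue⁺ (suc (suc (suc (suc n)))) = residue⁺ n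
  residue⁻ : ∀ n → stripe (-[1+ n ] + + 2) ≡ opp (stripe -[1+ n ])
  residue⁻ 0 = refl
  residue⁻ 1 = refl
  residue⁻ 2 = refl
  residue⁻ 3 = refl
  residue⁻ 4 = refl
  residue⁻ 5 = refl
  -- The recursion stops at `n` at least 2: for smaller `n`, adding 2 to `-[1+ n ]` leaves the
  -- negative numbers.
  residue⁻ (suc (suc (suc (suc n@(suc (suc _)))))) = residue⁻ n
  residue : ∀ k → stripe (k + + 2) ≡ opp (stripe k)
  residue (+ n)    = residue⁺ n
  residue -[1+ n ] = residue⁻ n


pairs-start : ∀ p → pairs p p ≡ dark × pairs p (p + 1ℤ) ≡ dark
pairs-start p = cong (λ k → if k %ℕ 4 ℕ.<ᵇ 2 then dark else pale) (zero-offset p) ,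
                cong (λ k → if k %ℕ 4 ℕ.<ᵇ 2 then dark else pale) (one-offset p)
  where
  zero-offset : ∀ p → p - p ≡ 0ℤ
  zero-offset = solve-∀
  one-offset : ∀ p → p + 1ℤ - p ≡ 1ℤ
  one-offset = solve-∀

antiperiodic⇒pairs : ∀ (f : ℤ → Colour) c → (∀ i → f (i + + 2) ≡ opp (f i)) →
  f (c - 1ℤ) ≡ f c → ∃[ p ] ∀ i → pairs p i ≡ f i
antiperiodic⇒pairs f c step eq with f c in fc
... | dark = p , two-step-unique opp opp-involutive (pairs p) f c (pairs-step p) step
      (trans (proj₁ (pairs-start p)) (sym eq))
      (trans (cong (pairs p) (sym (next c))) (trans (proj₂ (pairs-start p)) (sym fc)))
  where
  -- The values at `c - 1` and `c` form a dark pair.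
  p = c - 1ℤ
  next : ∀ c → c - 1ℤ + 1ℤ ≡ c
  next = solve-∀
... | pale = p , two-step-unique opp opp-involutive (pairs p) f c (pairs-step p) step
      (trans (before (c - 1ℤ) (trans (cong (pairs p) (start c)) (proj₁ (pairs-start p)))) (sym eq))
      (trans (before c (trans (cong (pairs p) (next c)) (proj₂ (pairs-start p)))) (sym fc))
  where
  -- The values at `c - 1` and `c` form a pale pair, so the next dark pair starts at `c + 1`.
  p = c + 1ℤ
  start : ∀ c → c - 1ℤ + + 2 ≡ c + 1ℤ
  start = solve-∀
  next : ∀ c → c + + 2 ≡ c + 1ℤ + 1ℤ
  next = solve-∀
  before : ∀ i → pairs p (i + + 2) ≡ dark → pairs p i ≡ pale
  before i h = trans (sym (opp-involutive _)) (cong opp (trans (sym (pairs-step p i)) h))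

-- Strand functions under a quarter-turn

warp-injective : ∀ {i j} → warp i ≡ warp j → i ≡ j
warp-injective refl = refl

turn : ℤ → ℤ → Isometry
turn t u = crossed (flip t) (shift u)

translation : ℤ → ℤ → Isometry
translation x y = straight (shift x) (shift y)

-- Applied to levels with `φ = act s`, and to scores with `φ` the identity.
module _ {A : Set} (φ : A → A) (φφ : ∀ x → φ (φ x) ≡ x) (f : Strand → A) (t u : ℤ)
         (f-turn : ∀ z → f (onStrand (turn t u) z) ≡ φ (f z)) where

  weft-from-warp : ∀ j → f (weft j) ≡ φ (f (warp (j - u)))
  weft-from-warp j = trans (cong (f ∘ weft) (restore j u)) (f-turn (warp (j - u)))
    where
    restore : ∀ j u → j ≡ j - u + u
    restore = solve-∀

  -- The square of the turn is a half-turn, and it acts on values by `φ` twice.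
  warp-half-turn : ∀ i → f (warp (t - u - (i + 1ℤ))) ≡ f (warp i)
  warp-half-turn i = begin
    f (warp (t - u - (i + 1ℤ)))  ≡⟨ cong (f ∘ warp) (regroup t u i) ⟩
    f (warp (t - (i + u + 1ℤ)))  ≡⟨ f-turn (weft (i + u)) ⟩
    φ (f (weft (i + u)))         ≡⟨ cong φ (f-turn (warp i)) ⟩
    φ (φ (f (warp i)))           ≡⟨ φφ _ ⟩
    f (warp i)                   ∎
    where
    open ≡-Reasoning
    regroup : ∀ t u i → t - u - (i + 1ℤ) ≡ t - (i + u + 1ℤ)
    regroup = solve-∀

  weft-step : (ψ : A → A) → (∀ x → φ (ψ x) ≡ ψ (φ x)) → ∀ m →
    (∀ i → f (warp (i + m)) ≡ ψ (f (warp i))) → ∀ j → f (weft (j + m)) ≡ ψ (f (weft j))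
  weft-step ψ comm m step j = begin
    f (weft (j + m))            ≡⟨ weft-from-warp (j + m) ⟩
    φ (f (warp (j + m - u)))    ≡⟨ cong (φ ∘ f ∘ warp) (regroup j m u) ⟩
    φ (f (warp (j - u + m)))    ≡⟨ cong φ (step (j - u)) ⟩
    φ (ψ (f (warp (j - u))))    ≡⟨ comm _ ⟩
    ψ (φ (f (warp (j - u))))    ≡⟨ cong ψ (weft-from-warp j) ⟨
    ψ (f (weft j))              ∎
    where
    open ≡-Reasoning
    regroup : ∀ j m u → j + m - u ≡ j - u + m
    regroup = solve-∀

  -- The centre of the turn has the integer `c` as first coordinate, so the half-turn about it
  -- exchanges the two warps on either side.
  warp-pair : ∀ c → t - u ≡ + 2 * c → f (warp (c - 1ℤ)) ≡ f (warp c)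
  warp-pair c eq = trans (cong (f ∘ warp)
      (trans (centre c) (cong (_- (c + 1ℤ)) (sym eq)))) (warp-half-turn c)
    where
    centre : ∀ c → c - 1ℤ ≡ + 2 * c - (c + 1ℤ)
    centre = solve-∀

  weft-pair : ∀ c → t - u ≡ + 2 * c → f (weft (c + u - 1ℤ)) ≡ f (weft (c + u))
  weft-pair c eq = begin
    f (weft (c + u - 1ℤ))           ≡⟨ weft-from-warp _ ⟩
    φ (f (warp (c + u - 1ℤ - u)))   ≡⟨ cong (φ ∘ f ∘ warp) (below c u) ⟩
    φ (f (warp (c - 1ℤ)))           ≡⟨ cong φ (warp-pair c eq) ⟩
    φ (f (warp c))                  ≡⟨ cong (φ ∘ f ∘ warp) (at c u) ⟩
    φ (f (warp (c + u - u)))        ≡⟨ weft-from-warp _ ⟨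
    f (weft (c + u))                ∎
    where
    open ≡-Reasoning
    below : ∀ c u → c + u - 1ℤ - u ≡ c - 1ℤ
    below = solve-∀
    at : ∀ c u → c ≡ c + u - u
    at = solve-∀

  warps-constant : ∀ c → t - u ≡ + 2 * c → (∀ i → f (warp (i + + 2)) ≡ f (warp i)) →
    ∀ i → f (warp i) ≡ f (warp c)
  warps-constant c eq step = two-step-unique id (λ _ → refl) (f ∘ warp) (λ _ → f (warp c)) c
    step (λ _ → refl) (warp-pair c eq) refl

opp-act : ∀ s x → act s (opp x) ≡ opp (act s x)
opp-act e _ = refl
opp-act τ _ = refl

-- A quarter-turn about the centre of a cell exchanges the strands crossing there.
cell-centred-turn : ∀ δ t u s c → t - u ≡ + 2 * c + 1ℤ → Invariant δ (turn t u , s) → s ≡ τ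
cell-centred-turn δ t u τ c eq I = refl
cell-centred-turn δ t u e c eq I = contradiction
  (trans (sym (I (c , c + u))) (cong (λ x → δ (x , c + u)) (trans (regroup t u c)
    (trans (cong (_- (c + 1ℤ)) eq) (central c))))) opp≢
  where
  regroup : ∀ t u c → t - (c + u + 1ℤ) ≡ t - u - (c + 1ℤ)
  regroup = solve-∀
  central : ∀ c → + 2 * c + 1ℤ - (c + 1ℤ) ≡ c
  central = solve-∀

-- Motions of the prefabric and the levels of its strands

module Geometry (P : Prefabric) (nonExceptional : NonExceptional P)
  (transitive : ∀ s t → ∃[ m ] Invariant (design P) m × onStrand (proj₁ m) s ≡ t)
  (level : Strand → Colour)
  (level-onStrand : ∀ g s → Invariant (design P) (g , s) →
    ∀ z → level (onStrand g z) ≡ act s (level z))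
  (level-not-constant : ¬ (∀ s t → level s ≡ level t))
  (dark-beats-pale : ∀ s k → level s ≡ dark → level (cross s k) ≡ pale →
    beats (design P) s k ≡ dark)
  (t u : ℤ) (s : Sign) (Q : Invariant (design P) (turn t u , s)) where

  private
    δ : Design
    δ = design P

  level-turn : ∀ z → level (onStrand (turn t u) z) ≡ act s (level z)
  level-turn = level-onStrand (turn t u) s Q

  no-reflection : ∀ g σ → Invariant δ (g , σ) → ¬ ReflectionOrGlide g
  no-reflection g σ I = nonExceptional (g , σ) (invariant⇒symmetry P (g , σ) I)

  level-translation : ∀ x y σ → Invariant δ (translation x y , σ) →
    ∀ z → level (onStrand (translation x y) z) ≡ act σ (level z)
  level-translation x y = level-onStrand (translation x y)

  -- A constant design would be preserved by reflections, which `P` does not admit.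
  design-not-constant : ¬ (∃[ x ] ∀ c → δ c ≡ x)
  design-not-constant (x , h) = no-reflection (straight (flip 0ℤ) (shift 0ℤ)) e
    (λ c → trans (h _) (sym (h c))) (vertical 0ℤ 0ℤ)

  -- The turn would give all wefts a common level as well. If it is that of the warps, all levels
  -- agree; otherwise the warps lie all over or all under the wefts, and the design is constant.
  warp-levels-not-constant : ¬ (∃[ x ] ∀ i → level (warp i) ≡ x)
  warp-levels-not-constant (x , warps) = by-sign s wefts
    where
    wefts : ∀ j → level (weft j) ≡ act s x
    wefts j = trans (weft-from-warp (act s) (act-involutive s) level t u level-turn j)
      (cong (act s) (warps (j - u)))
    on-top : ∀ x → (∀ i → level (warp i) ≡ x) → (∀ j → level (weft j) ≡ opp x) → ∀ c → δ c ≡ x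
    on-top dark hw hf (i , j) = dark-beats-pale (warp i) j (hw i) (hf j)
    on-top pale hw hf (i , j) = trans (sym (opp-involutive _))
      (cong opp (dark-beats-pale (weft j) i (hf j) (hw i)))
    by-sign : ∀ s → (∀ j → level (weft j) ≡ act s x) → ⊥
    by-sign e hf = level-not-constant λ { y z → trans (all y) (sym (all z)) }
      where
      all : ∀ z → level z ≡ x
      all (warp i) = warps i
      all (weft j) = hf j
    by-sign τ hf = design-not-constant (x , on-top x warps hf)

  half-turn : Invariant δ (straight (flip (t - u)) (flip (t + u)) , e)
  half-turn = subst (λ σ → Invariant δ (straight (flip (t - u)) (flip (t + u)) , σ))
    (square s) (invariant-∙ δ (turn t u , s) (turn t u , s) Q Q)
    where
    square : ∀ s → s Sign.* s ≡ e
    square e = refl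
    square τ = refl

  -- A motion carrying warp c to warp (c + 1) is a translation or, after
  -- composition with the half-turn, becomes one.
  some-translation : ∀ c → ∃₂ λ y σ → Invariant δ (translation 1ℤ y , σ)
    ⊎ Invariant δ (translation (+ 2 * c + + 2 - (t - u)) y , σ)
  -- An isometry that carries a warp to a warp is `straight`, so only four cases arise; two of them
  -- are reflections or glide-reflections.
  some-translation c with transitive (warp c) (warp (c + 1ℤ))
  ... | (straight (shift x) (shift y) , σ) , I , eq =
    y , σ , inj₁ (subst (λ x → Invariant δ (translation x y , σ)) x≡1 I)
    where
    restore : ∀ c x → x ≡ c + x - c
    restore = solve-∀
    x≡1 : x ≡ 1ℤ
    x≡1 = trans (restore c x) (trans (cong (_- c) (warp-injective eq)) (sym (restore c 1ℤ)))
  ... | (straight (flip x) (flip y) , σ) , I , eq =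
    y - (t + u) , σ Sign.* e , inj₂ (subst
      (λ x → Invariant δ (translation (x - (t - u)) (y - (t + u)) , σ Sign.* e)) x≡
      (invariant-∙ δ (straight (flip x) (flip y) , σ)
        (straight (flip (t - u)) (flip (t + u)) , e) I half-turn))
    where
    restore : ∀ x c → x ≡ x - (c + 1ℤ) + (c + 1ℤ)
    restore = solve-∀
    double : ∀ c → c + 1ℤ + (c + 1ℤ) ≡ + 2 * c + + 2
    double = solve-∀
    x≡ : x ≡ + 2 * c + + 2
    x≡ = trans (restore x c) (trans (cong (_+ (c + 1ℤ)) (warp-injective eq)) (double c))
  ... | (straight (flip x) (shift y) , σ) , I , eq =
    contradiction (vertical x y) (no-reflection (straight (flip x) (shift y)) σ I)
  ... | (straight (shift x) (flip y) , σ) , I , eq =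
    contradiction (horizontal x y) (no-reflection (straight (shift x) (flip y)) σ I)

  -- A τ-translation by (1 , y) makes the levels alternate.  Then the strands
  -- adjacent to a corner-centred half-turn have opposite levels, although the
  -- half-turn exchanges them; and for a cell-centred turn, y is odd, so that
  -- composition with the translation yields a cell-centred turn without τ.
  no-unit-translation : ∀ y σ → ¬ Invariant δ (translation 1ℤ y , σ)
  no-unit-translation y e T = warp-levels-not-constant (level (warp 0ℤ) ,
    constant-from-0 (level ∘ warp) λ i → level-translation 1ℤ y e T (warp i))
  no-unit-translation y τ T with even-or-odd (t - u)
  ... | inj₁ (c , eq) = contradiction
    (trans (sym (level-translation 1ℤ y τ T (warp (c - 1ℤ))))
      (trans (cong (level ∘ warp) (next c))
        (sym (warp-pair (act s) (act-involutive s) level t u level-turn c eq)))) opp≢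
    where
    next : ∀ c → c - 1ℤ + 1ℤ ≡ c
    next = solve-∀
  ... | inj₂ (c , eq) with even-or-odd y
  -- Translation by an even `y` preserves the alternating levels of the wefts, whereas `T` reverses
  -- them.
  ...   | inj₁ (m , refl) = contradiction
    (trans (sym (level-translation 1ℤ y τ T (weft 0ℤ)))
      (trans (cong (λ z → level (weft (0ℤ + z))) (ℤ.*-comm (+ 2) m))
        (periodic-* (level ∘ weft) (+ 2) weft-2 m 0ℤ))) opp≢
    where
    weft-1 : ∀ j → level (weft (j + 1ℤ)) ≡ opp (level (weft j))
    weft-1 = weft-step (act s) (act-involutive s) level t u level-turn opp (opp-act s) 1ℤ
      λ i → level-translation 1ℤ y τ T (warp i)
    two-steps : ∀ i → i + + 2 ≡ i + 1ℤ + 1ℤ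
    two-steps = solve-∀
    weft-2 : ∀ j → level (weft (j + + 2)) ≡ level (weft j)
    weft-2 j = trans (cong (level ∘ weft) (two-steps j))
      (trans (weft-1 (j + 1ℤ)) (trans (cong opp (weft-1 j)) (opp-involutive _)))
  ...   | inj₂ (m , refl) = contradiction
    (cell-centred-turn δ (t + 1ℤ) (u + (+ 2 * m + 1ℤ)) (τ Sign.* s) (c - m)
      (trans (regroup t u m) (trans (cong (_- (+ 2 * m)) eq) (central c m)))
      (invariant-∙ δ (translation 1ℤ y , τ) (turn t u , s) T Q))
    (λ τs≡τ → contradiction (trans (cong (τ Sign.*_) (sym s≡τ)) τs≡τ) λ ())
    where
    s≡τ : s ≡ τ
    s≡τ = cell-centred-turn δ t u s c eq Q
    regroup : ∀ t u m → t + 1ℤ - (u + (+ 2 * m + 1ℤ)) ≡ t - u - + 2 * m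
    regroup = solve-∀
    central : ∀ c m → + 2 * c + 1ℤ - + 2 * m ≡ + 2 * (c - m) + 1ℤ
    central = solve-∀

  -- The turn is about a corner or about the centre of a cell, according to the parity of `t - u`.
  -- The second translation of `some-translation` moves warps by 2 or by 1 accordingly; as steps of
  -- 1 are impossible, the first case holds.
  corner-and-translation : ∃₂ λ c y → ∃[ σ ]
    t - u ≡ + 2 * c × Invariant δ (translation (+ 2) y , σ)
  corner-and-translation with even-or-odd (t - u)
  ... | inj₁ (c , eq) with some-translation c
  ...   | y , σ , inj₁ T = contradiction T (no-unit-translation y σ)
  ...   | y , σ , inj₂ T = c , y , σ , eq , subst (λ x → Invariant δ (translation x y , σ))
    (trans (cong (λ z → + 2 * c + + 2 - z) eq) (cancel c)) T
    where
    cancel : ∀ c → + 2 * c + + 2 - + 2 * c ≡ + 2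
    cancel = solve-∀
  corner-and-translation | inj₂ (c , eq) with some-translation c
  ...   | y , σ , inj₁ T = contradiction T (no-unit-translation y σ)
  ...   | y , σ , inj₂ T = contradiction
    (subst (λ x → Invariant δ (translation x y , σ))
      (trans (cong (λ z → + 2 * c + + 2 - z) eq) (cancel c)) T)
    (no-unit-translation y σ)
    where
    cancel : ∀ c → + 2 * c + + 2 - (+ 2 * c + 1ℤ) ≡ 1ℤ
    cancel = solve-∀

  module _ (c y : ℤ) (eq : t - u ≡ + 2 * c) where

    -- Without `τ`, the levels of the warps would have period 2 and two equal neighbours, hence be
    -- constant.
    translation-reverses : ∀ σ → Invariant δ (translation (+ 2) y , σ) → σ ≡ τ
    translation-reverses τ T = refl
    translation-reverses e T = contradiction (level (warp c) ,
      warps-constant (act s) (act-involutive s) level t u level-turn c eq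
        λ i → level-translation (+ 2) y e T (warp i)) warp-levels-not-constant

    module _ (T : Invariant δ (translation (+ 2) y , τ)) where

      warp-2 : ∀ i → level (warp (i + + 2)) ≡ opp (level (warp i))
      warp-2 i = level-translation (+ 2) y τ T (warp i)

      weft-2 : ∀ j → level (weft (j + + 2)) ≡ opp (level (weft j))
      weft-2 = weft-step (act s) (act-involutive s) level t u level-turn
        opp (opp-act s) (+ 2) warp-2

      weft-y : ∀ j → level (weft (j + y)) ≡ opp (level (weft j))
      weft-y j = level-translation (+ 2) y τ T (weft j)

      weft-4 : ∀ k j → level (weft (j + k * + 4)) ≡ level (weft j)
      weft-4 = periodic-* (level ∘ weft) (+ 4) λ j → trans (cong (level ∘ weft) (split j))
        (trans (weft-2 (j + + 2)) (trans (cong opp (weft-2 j)) (opp-involutive _)))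
        where
        split : ∀ j → j + + 4 ≡ j + + 2 + + 2
        split = solve-∀

      private
        pair : level (weft (c + u - 1ℤ)) ≡ level (weft (c + u))
        pair = weft-pair (act s) (act-involutive s) level t u level-turn c eq

        steps-between-pairs : ¬ (∀ j → level (weft (j + 1ℤ)) ≡ opp (level (weft j)))
        steps-between-pairs h = contradiction
          (trans (sym (h (c + u - 1ℤ))) (trans (cong (level ∘ weft) (next (c + u))) (sym pair))) opp≢
          where
          next : ∀ z → z - 1ℤ + 1ℤ ≡ z
          next = solve-∀

      -- The levels of the wefts have the pattern ++--, and a translation by y
      -- reverses them.
      y≡2mod4 : ∃[ k ] y ≡ + 4 * k + + 2
      y≡2mod4 with even-or-odd y
      ... | inj₁ (m , refl) with even-or-odd m
      ...   | inj₂ (k , refl) = k , double k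
        where
        double : ∀ k → + 2 * (+ 2 * k + 1ℤ) ≡ + 4 * k + + 2
        double = solve-∀
      -- Here `y = 4k`, and such a step preserves the levels of wefts.
      ...   | inj₁ (k , refl) = contradiction
        (trans (sym (weft-y 0ℤ)) (trans (cong (level ∘ weft) (quadruple k)) (weft-4 k 0ℤ))) opp≢
        where
        quadruple : ∀ k → 0ℤ + + 2 * (+ 2 * k) ≡ 0ℤ + k * + 4
        quadruple = solve-∀
      y≡2mod4 | inj₂ (m , refl) with even-or-odd m
      -- Here `y = 4k + 1`, so single steps would reverse levels, although the two wefts adjacent to
      -- the centre have equal levels.
      ...   | inj₁ (k , refl) = contradiction
        (λ j → trans (sym (weft-4 k (j + 1ℤ))) (trans (cong (level ∘ weft) (regroup j k)) (weft-y j)))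
        steps-between-pairs
        where
        regroup : ∀ j k → j + 1ℤ + k * + 4 ≡ j + (+ 2 * (+ 2 * k) + 1ℤ)
        regroup = solve-∀
      -- Here `y = 4k + 3`, so steps of 3 reverse levels, as do steps of 2. Single steps then
      -- preserve levels, and steps of 2 could not reverse them.
      ...   | inj₂ (k , refl) = contradiction
        (trans (sym (weft-2 0ℤ)) (trans (weft-1 1ℤ) (weft-1 0ℤ))) opp≢
        where
        regroup : ∀ j k → j + 1ℤ + + 2 + k * + 4 ≡ j + (+ 2 * (+ 2 * k + 1ℤ) + 1ℤ)
        regroup = solve-∀
        weft-1 : ∀ j → level (weft (j + 1ℤ)) ≡ level (weft j)
        weft-1 j = begin
          level (weft (j + 1ℤ))                      ≡⟨ opp-involutive _ ⟨
          opp (opp (level (weft (j + 1ℤ))))          ≡⟨ cong opp (weft-2 (j + 1ℤ)) ⟨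
          opp (level (weft (j + 1ℤ + + 2)))          ≡⟨ cong opp (weft-4 k (j + 1ℤ + + 2)) ⟨
          opp (level (weft (j + 1ℤ + + 2 + k * + 4))) ≡⟨ cong (opp ∘ level ∘ weft) (regroup j k) ⟩
          opp (level (weft (j + (+ 2 * (+ 2 * k + 1ℤ) + 1ℤ)))) ≡⟨ cong opp (weft-y j) ⟩
          opp (opp (level (weft j)))                 ≡⟨ opp-involutive _ ⟩
          level (weft j)                             ∎
          where open ≡-Reasoning

-- The fabric

-- Warp level, weft level, the design of P, and the free choice where the
-- levels differ.
fill : Colour → Colour → Colour → Colour → Colour
fill dark dark x _ = x
fill pale pale x _ = opp x
fill dark pale _ y = y
fill pale dark _ y = y

-- For `s = τ` the turn takes crossings of two dark strands to crossings of two pale ones and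
-- conversely; `fill` reads the design reversed on exactly one of these kinds, which compensates for
-- the `τ`. Where levels differ, the free choice itself has to change colour.
fill-turn : ∀ s a b x y →
  fill (act s b) (act s a) (act (τ Sign.* s) x) (opp y) ≡ opp (fill a b x y)
fill-turn e dark dark x y = refl
fill-turn e dark pale x y = refl
fill-turn e pale dark x y = refl
fill-turn e pale pale x y = refl
fill-turn τ dark dark x y = refl
fill-turn τ dark pale x y = refl
fill-turn τ pale dark x y = refl
fill-turn τ pale pale x y = sym (opp-involutive x)

-- The colour seen at a cell whose warp has colour `x` and whose weft has colour `y`.
pick : Colour → Colour → Colour → Colour
pick dark x y = x
pick pale x y = y

-- Warps are coloured by their level, wefts by the opposite of theirs. At equal levels the two
-- colours differ, and the reversal in `fill` at pale crossings makes the right one visible. At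
-- different levels both strands have the colour that the cell has in `P`, so either may be on top.
fill-pick : ∀ a b x y → (a ≡ dark → b ≡ pale → x ≡ dark) → (b ≡ dark → a ≡ pale → x ≡ pale) →
  pick (fill a b x y) a (opp b) ≡ x
fill-pick dark dark dark _ _ _ = refl
fill-pick dark dark pale _ _ _ = refl
fill-pick pale pale dark _ _ _ = refl
fill-pick pale pale pale _ _ _ = refl
fill-pick dark pale x dark h _ = sym (h refl refl)
fill-pick dark pale x pale h _ = sym (h refl refl)
fill-pick pale dark x dark _ h = sym (h refl refl)
fill-pick pale dark x pale _ h = sym (h refl refl)

patternOf-pick : ∀ F κ i j →
  patternOf F κ (i , j) ≡ pick (design F (i , j)) (κ (warp i)) (κ (weft j))
patternOf-pick F κ i j with design F (i , j)
... | dark = refl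
... | pale = refl

separate : Design → (Strand → Colour) → Design
separate δ level (i , j) = fill (level (warp i)) (level (weft j)) (δ (i , j)) (checker (i + j))

-- That `t + u` is even means that the centre is a corner of cells, so the turn changes the parity
-- of `i + j` and flips the plain weave.
separate-turn : ∀ δ level t u s q → t + u ≡ + 2 * q → Invariant δ (turn t u , s) →
  (∀ z → level (onStrand (turn t u) z) ≡ act s (level z)) →
  Invariant (separate δ level) (turn t u , e)
separate-turn δ level t u s q eq I level-turn (i , j) = trans
  (cong₂ (λ (a , b) (x , y) → fill a b x y)
    (cong₂ _,_ (level-turn (weft j)) (level-turn (warp i)))
    (cong₂ _,_ (I (i , j)) checker-flips))
  (fill-turn s (level (warp i)) (level (weft j)) (δ (i , j)) (checker (i + j)))
  where
  regroup : ∀ t u i j → t - (j + 1ℤ) + (i + u) ≡ t + u + (i - j - 1ℤ)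
  regroup = solve-∀
  even-offset : ∀ q i j → + 2 * q + (i - j - 1ℤ) ≡ i + j + 1ℤ + (q - j - 1ℤ) * + 2
  even-offset = solve-∀
  checker-flips : checker (t - (j + 1ℤ) + (i + u)) ≡ opp (checker (i + j))
  checker-flips = begin
    checker (t - (j + 1ℤ) + (i + u))              ≡⟨ cong checker (regroup t u i j) ⟩
    checker (t + u + (i - j - 1ℤ))                ≡⟨ cong (λ z → checker (z + (i - j - 1ℤ))) eq ⟩
    checker (+ 2 * q + (i - j - 1ℤ))              ≡⟨ cong checker (even-offset q i j) ⟩
    checker (i + j + 1ℤ + (q - j - 1ℤ) * + 2)     ≡⟨ checker-even (i + j + 1ℤ) (q - j - 1ℤ) ⟩
    checker (i + j + 1ℤ)                          ≡⟨ checker-step (i + j) ⟩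
    opp (checker (i + j))                         ∎
    where open ≡-Reasoning

-- The period is taken even because the plain weave repeats only after 2 cells along a strand.
separate-periodic : ∀ n δ level → PeriodicBy (n ℕ.+ n) δ →
  (∀ i → level (warp (i + + (n ℕ.+ n))) ≡ level (warp i)) →
  (∀ j → level (weft (j + + (n ℕ.+ n))) ≡ level (weft j)) →
  PeriodicBy (n ℕ.+ n) (separate δ level)
separate-periodic n δ level (per-x , per-y) warps wefts =
  (λ i j → cong₂ (λ a (x , y) → fill a (level (weft j)) x y) (warps i)
    (cong₂ _,_ (per-x i j) (checker-N _ (i + j) (right i j (+ n))))) ,
  (λ i j → cong₂ (λ b (x , y) → fill (level (warp i)) b x y) (wefts j)
    (cong₂ _,_ (per-y i j) (checker-N _ (i + j) (up i j (+ n)))))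
  where
  right : ∀ i j n → i + (n + n) + j ≡ i + j + n * + 2
  right = solve-∀
  up : ∀ i j n → i + (j + (n + n)) ≡ i + j + n * + 2
  up = solve-∀
  checker-N : ∀ k l → k ≡ l + + n * + 2 → checker k ≡ checker l
  checker-N _ l eq = trans (cong checker eq) (checker-even l (+ n))

periodicBy⇒periodic : ∀ N δ → 0 ℕ.< N → PeriodicBy N δ → Periodic δ
periodicBy⇒periodic N@(suc _) δ _ (per-x , per-y) =
  (+ N , 0ℤ) , (0ℤ , + N) , (λ ()) ,
  (λ i j → trans (cong (λ y → δ (i + + N , y)) (ℤ.+-identityʳ j)) (per-x i j)) ,
  (λ i j → trans (cong (λ x → δ (x , j + + N)) (ℤ.+-identityʳ i)) (per-y i j))

-- The composition of one quarter-turn with the inverse of the other is the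
-- translation by (2 , y), so the two are transitive on the strands.
two-turns⇒equal-scores : ∀ N δ t u y c → PeriodicBy N δ → t - u ≡ + 2 * c →
  Invariant δ (turn t u , e) → Invariant δ (turn (t + + 2) (u + y) , e) →
  ∀ z z′ → score N δ z ≡ score N δ z′
two-turns⇒equal-scores N δ t u y c periodic eq I J z z′ = trans (all z) (sym (all z′))
  where
  D = score N δ
  D-turn : ∀ z → D (onStrand (turn t u) z) ≡ D z
  D-turn = score-onStrand periodic (turn t u) e I
  translate : ∀ t i → i + + 2 ≡ t + + 2 - (t - (i + 1ℤ) + 1ℤ)
  translate = solve-∀
  return : ∀ t i → t - (t - (i + 1ℤ) + 1ℤ) ≡ i
  return = solve-∀
  step : ∀ i → D (warp (i + + 2)) ≡ D (warp i)
  step i = begin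
    D (warp (i + + 2))                                ≡⟨ cong (D ∘ warp) (translate t i) ⟩
    D (warp (t + + 2 - (t - (i + 1ℤ) + 1ℤ)))
      ≡⟨ score-onStrand periodic (turn (t + + 2) (u + y)) e J (weft (t - (i + 1ℤ))) ⟩
    D (weft (t - (i + 1ℤ)))                           ≡⟨ D-turn (weft (t - (i + 1ℤ))) ⟨
    D (warp (t - (t - (i + 1ℤ) + 1ℤ)))                ≡⟨ cong (D ∘ warp) (return t i) ⟩
    D (warp i)                                        ∎
    where open ≡-Reasoning
  warps : ∀ i → D (warp i) ≡ D (warp c)
  warps = warps-constant id (λ _ → refl) D t u D-turn c eq step
  all : ∀ z → D z ≡ D (warp c)
  all (warp i) = warps i
  all (weft j) = trans (weft-from-warp id (λ _ → refl) D t u D-turn j) (warps (j - u))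

generated⇒symmetry : ∀ F S → S ⊆ Invariant (design F) → ⟨ S ⟩ ⊆ Symmetry F
generated⇒symmetry F S S⊆ {m} x = invariant⇒symmetry F m (invariant x)
  where
  invariant : ∀ {m} → ⟨ S ⟩ m → Invariant (design F) m
  invariant (generator x)         = S⊆ x
  invariant neutral               = invariant-unit (design F)
  invariant (product {m} {n} x y) = invariant-∙ (design F) m n (invariant x) (invariant y)
  invariant (inverse {m} x)       = invariant-⁻¹ (design F) m (invariant x)

-- The subgroup is the group generated by the two turns, so what remains is that the generators are
-- symmetries of `F`.
two-turns⇒subgroup33₄ : ∀ F p q k →
  Invariant (design F) (quarterTurnAbout (p , q) , e) →
  Invariant (design F) (quarterTurnAbout (p + + 2 * - k , q + + 2 * (k + 1ℤ)) , e) →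
  HasSubgroup33₄ F
two-turns⇒subgroup33₄ F p q k I J =
  ⟨ _ ⟩ , ((p , q) , (- k , k + 1ℤ) , consecutive-coprime k , consecutive-parity k , id , id) ,
  generated⇒symmetry F _ λ { (inj₁ refl) → I ; (inj₂ refl) → J }

-- Assembly of the striped fabric

anticlockwise-turn : ∀ P → HasQuarterTurnSymmetry P →
  ∃₂ λ t u → ∃[ s ] Invariant (design P) (turn t u , s)
anticlockwise-turn P ((_ , s) , S , anticlockwise t u) =
  t , u , s , symmetry⇒invariant P (turn t u , s) S
anticlockwise-turn P ((g , s) , S , clockwise t u) =
  -- A clockwise turn is replaced by its inverse.
  u , - t , s , invariant-⁻¹ (design P) (g , s) (symmetry⇒invariant P (g , s) S)

isonemal⇒transitive : ∀ P → Isonemal P →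
  ∀ s t → ∃[ m ] Invariant (design P) m × onStrand (proj₁ m) s ≡ t
isonemal⇒transitive P isonemal s t with isonemal s t
... | m , S , eq = m , symmetry⇒invariant P m S , eq

StripedFabric33₄ : Prefabric → Set₁
StripedFabric33₄ P = Σ[ F ∈ Prefabric ] IsFabric F ×
  (∃₂ λ p q → ∀ c → patternOf F (thickStriping p q) c ≡ design P c) ×
  (Species33₄ F ⊎ HasSubgroup33₄ F)

module Construction (P : Prefabric) (nonExceptional : NonExceptional P)
  (transitive : ∀ s t → ∃[ m ] Invariant (design P) m × onStrand (proj₁ m) s ≡ t)
  (A : Strand → Bool) (cut : Cut (design P) A)
  (above : ∃[ x ] A x ≡ true) (below : ∃[ x ] A x ≡ false)
  (n : ℕ) (0<n : 0 ℕ.< n) (P-periodic : PeriodicBy (n ℕ.+ n) (design P))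
  (t u : ℤ) (s : Sign) (Q : Invariant (design P) (turn t u , s)) where

  private
    δ = design P
    N = n ℕ.+ n

    0<N : 0 ℕ.< N
    0<N = ℕ.≤-trans 0<n (ℕ.m≤m+n n n)

    module L = Levels N 0<N δ P-periodic transitive A cut above below
    module G = Geometry P nonExceptional transitive L.level L.level-onStrand
      L.level-not-constant L.dark-beats-pale t u s Q

  F-periodic : PeriodicBy N (separate δ L.level)
  F-periodic = separate-periodic n δ L.level P-periodic
    -- Parallel strands a period apart beat alike, so they have equal scores.
    (λ i → cong (balance N) (count-cong N (proj₁ P-periodic i)))
    (λ j → cong (balance N) (count-cong N λ i → cong opp (proj₂ P-periodic i j)))

  F : Prefabric
  F = record { design = separate δ L.level
             ; periodic = periodicBy⇒periodic N _ 0<N F-periodic }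

  pattern-F : ∀ p q → (∀ i → pairs p i ≡ L.level (warp i)) →
    (∀ j → pairs q j ≡ opp (L.level (weft j))) →
    ∀ c → patternOf F (thickStriping p q) c ≡ δ c
  pattern-F p q warps wefts (i , j) = begin
    patternOf F (thickStriping p q) (i , j)
      ≡⟨ patternOf-pick F (thickStriping p q) i j ⟩
    pick (design F (i , j)) (pairs p i) (pairs q j)
      ≡⟨ cong₂ (pick (design F (i , j))) (warps i) (wefts j) ⟩
    pick (design F (i , j)) (L.level (warp i)) (opp (L.level (weft j)))
      ≡⟨ fill-pick (L.level (warp i)) (L.level (weft j)) (δ (i , j)) (checker (i + j))
           (L.dark-beats-pale (warp i) j)
           (λ lw lf → trans (sym (opp-involutive _))
             (cong opp (L.dark-beats-pale (weft j) i lw lf))) ⟩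
    δ (i , j) ∎
    where open ≡-Reasoning

  module _ (c k : ℤ) (eq : t - u ≡ + 2 * c)
    (T : Invariant δ (translation (+ 2) (+ 4 * k + + 2) , τ)) where

    private
      y = + 4 * k + + 2

    restore : ∀ t u → t ≡ t - u + u
    restore = solve-∀
    t≡ : t ≡ + 2 * c + u
    t≡ = trans (restore t u) (cong (_+ u) eq)
    centre : ∀ c u → + 2 * c + u + u ≡ + 2 * (c + u)
    centre = solve-∀
    centre′ : ∀ c u k → + 2 * c + u + + 2 + (u + (+ 4 * k + + 2)) ≡ + 2 * (c + u + + 2 * k + + 2)
    centre′ = solve-∀

    TQ : Invariant δ (turn (t + + 2) (u + y) , τ Sign.* s)
    TQ = invariant-∙ δ (translation (+ 2) y , τ) (turn t u , s) T Q

    F-Q : Invariant (design F) (turn t u , e)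
    F-Q = separate-turn δ L.level t u s (c + u) (trans (cong (_+ u) t≡) (centre c u)) Q G.level-turn

    F-TQ : Invariant (design F) (turn (t + + 2) (u + y) , e)
    F-TQ = separate-turn δ L.level (t + + 2) (u + y) (τ Sign.* s) (c + u + + 2 * k + + 2)
      (trans (cong (λ z → z + + 2 + (u + y)) t≡) (centre′ c u k)) TQ
      (L.level-onStrand (turn (t + + 2) (u + y)) (τ Sign.* s) TQ)

    F-fabric : IsFabric F
    F-fabric fa@(B , B-above , B-below , _) = equal-scores-no-cut N (design F) B 0<N
      (fallsApart⇒cut F fa) B-above B-below
      (two-turns⇒equal-scores N (design F) t u y c F-periodic eq F-Q F-TQ)

    warp-pairs : ∃[ p ] ∀ i → pairs p i ≡ L.level (warp i)
    warp-pairs = antiperiodic⇒pairs (L.level ∘ warp) c (G.warp-2 c y eq T)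
      (warp-pair (act s) (act-involutive s) L.level t u G.level-turn c eq)

    weft-pairs : ∃[ q ] ∀ j → pairs q j ≡ opp (L.level (weft j))
    weft-pairs = antiperiodic⇒pairs (opp ∘ L.level ∘ weft) (c + u)
      (λ j → cong opp (G.weft-2 c y eq T j))
      (cong opp (weft-pair (act s) (act-involutive s) L.level t u G.level-turn c eq))

    flip₁ : ∀ c u → + 2 * c + u ≡ c + (c + u)
    flip₁ = solve-∀
    shift₁ : ∀ c u → u ≡ c + u - c
    shift₁ = solve-∀
    flip₂ : ∀ c u k → + 2 * c + u + + 2 ≡ c + + 2 * - k + (c + u + + 2 * (k + 1ℤ))
    flip₂ = solve-∀
    shift₂ : ∀ c u k → u + (+ 4 * k + + 2) ≡ c + u + + 2 * (k + 1ℤ) - (c + + 2 * - k)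
    shift₂ = solve-∀

    -- The centre `(p , q)` solves `p + q = t` and `q - p = u`.
    first-turn : turn t u ≡ quarterTurnAbout (c , c + u)
    first-turn = cong₂ turn (trans t≡ (flip₁ c u)) (shift₁ c u)

    -- Adding 2 to `t` and `y` to `u` moves the centre by `((2 - y) / 2 , (2 + y) / 2)`, which is
    -- `2 (- k , k + 1)` for `y = 4k + 2`.
    second-turn : turn (t + + 2) (u + y) ≡ quarterTurnAbout (c + + 2 * - k , c + u + + 2 * (k + 1ℤ))
    second-turn = cong₂ turn (trans (cong (_+ + 2) t≡) (flip₂ c u k)) (shift₂ c u k)

    fabric-from-translation : StripedFabric33₄ P
    fabric-from-translation =
      F , F-fabric ,
      (proj₁ warp-pairs , proj₁ weft-pairs , pattern-F _ _ (proj₂ warp-pairs) (proj₂ weft-pairs)) ,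
      -- The two turns generate a subgroup; whether it is the whole symmetry group of `F` is left
      -- open.
      inj₂ (two-turns⇒subgroup33₄ F c (c + u) k
        (subst (λ g → Invariant (design F) (g , e)) first-turn F-Q)
        (subst (λ g → Invariant (design F) (g , e)) second-turn F-TQ))

  striped-fabric : StripedFabric33₄ P
  striped-fabric with G.corner-and-translation
  ... | c , y , σ , eq , T with G.translation-reverses c y eq σ T
  ...   | refl with G.y≡2mod4 c y eq T
  ...     | k , refl = fabric-from-translation c k eq T

theorem5p1 : (P : Prefabric) → NonExceptional P → Isonemal P →
    HasQuarterTurnSymmetry P → FallsApart P →
    Σ[ F ∈ Prefabric ] IsFabric F ×
    (∃₂ λ p q → ∀ c → patternOf F (thickStriping p q) c ≡ design P c) ×
    (Species33₄ F ⊎ HasSubgroup33₄ F)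
theorem5p1 P nonExceptional isonemal quarterTurn fallsApart@(A , above , below , _) =
  let n , 0<n , P-periodic = even-period (design P) (periodic P)
      t , u , s , Q = anticlockwise-turn P quarterTurn
  in Construction.striped-fabric P nonExceptional (isonemal⇒transitive P isonemal)
       A (fallsApart⇒cut P fallsApart) above below n 0<n P-periodic t u s Q
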